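{- With standard resolution in place of SLD-resolution, the fragment $\mathcal{H}^{2c}_{2,\infty}$ is reducible$_R$ to $\mathcal{H}^{2c}_{2,2}$. That is, for every $C\in\mathcal{H}^{2c}_{2,\infty}$ with $|C|>2$, there exists $b'<|C|$ such that $C$ is the conclusion of a standard-resolution inference whose premises lie in $\mathcal{H}^{2c}_{2,b'}$.
   Context: Clauses and fragments. - Clauses are function-free second-order Horn clauses: a head (at most one positive literal) and a finite body of negative literals. Each literal is a predicate variable of arity in $\mathbb{N}^*$ applied to term variables. - The body size $|C|$ is the number of body literals. - A clause is connected if its literals cannot be partitioned into two non-empty sets with disjoint variable sets. - $\mathcal{H}^{2c}$ is the set of connected clauses in which every term variable occurs in at least two distinct literals. - $\mathcal{H}^{2c}_{a,b}$ denotes those clauses with all literal arities at most $a$ and body size at most $b$; $\infty$ means no bound. - Fragments are considered modulo variable renaming and contain only the most general clauses up to variable unification. Standard resolution. - Substitutions map term variables to term variables and predicate variables to predicate variables of the same arity. - Standard resolution is resolution extended to these second-order clauses using most general unifiers under such substitutions. - Unlike SLD-resolution, it allows factoring: unifying two literals of the same clause and thereby merging duplicate literals. - In particular, an inference may resolve a body literal of one premise against the head of another and then factor the resolvent. Reducibility$_R$. A fragment $\mathcal{F}$ is reducible$_R$ to $\mathcal{F}_{\infty,b}$ if, for every $C\in\mathcal{F}$ with $b<|C|$, there exists $b'<|C|$ such that $C$ is the conclusion of a standard-resolution inference with premises in $\mathcal{F}_{\infty,b'}$. -}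

module Defs where

open import Data.Nat using (ℕ; _≤_; _<_; suc)
open import Data.Bool using (Bool; true; false)
open import Data.List using (List; []; _∷_; _++_; map; length; lookup)
open import Data.List.Membership.Propositional using (_∈_)
open import Data.List.Relation.Unary.All using (All)
open import Data.List.Relation.Unary.Unique.Propositional using (Unique)
open import Data.List.Relation.Binary.Permutation.Propositional using (_↭_)
open import Data.Maybe using (Maybe; just; nothing)
open import Data.Fin using (Fin)
open import Data.Product using (Σ; _×_; _,_; ∃; ∃-syntax)
open import Data.Empty using (⊥)
open import Relation.Nullary using (¬_)
open import Relation.Binary.PropositionalEquality using (_≡_; _≢_)

-- Syntax of function-free second-order Horn clauses.
-- Term variables are natural numbers.  A predicate variable is a name
-- (a natural number) together with an arity; the arity of a predicate
-- variable in a literal is the number of its arguments, so a predicate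
-- variable is identified by the pair (arity, name).

record Literal : Set where
  constructor lit
  field
    pred : ℕ
    args : List ℕ
open Literal public

arity : Literal → ℕ
arity l = length (args l)

-- A clause: at most one positive literal (the head) and a finite body
-- of negative literals.  Clauses are sets of literals: the body is
-- required to be duplicate-free (see WF), and clauses are compared as
-- sets (see _≅_).
record Clause : Set where
  constructor clause
  field
    head : Maybe Literal
    body : List Literal
open Clause public

size : Clause → ℕ
size C = length (body C)

headList : Maybe Literal → List Literal
headList (just h) = h ∷ []
headList nothing  = []

lits : Clause → List Literal
lits C = headList (head C) ++ body C

record Subst : Set where
  constructor subst
  field
    tm : ℕ → ℕ
    pr : ℕ → ℕ → ℕ    -- pr n p : image of predicate variable p of arity n
open Subst public

applyLit : Subst → Literal → Literal
applyLit σ (lit p as) = lit (pr σ (length as) p) (map (tm σ) as)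

applyHead : Subst → Maybe Literal → Maybe Literal
applyHead σ (just h) = just (applyLit σ h)
applyHead σ nothing  = nothing

applyClause : Subst → Clause → Clause
applyClause σ (clause h bs) = clause (applyHead σ h) (map (applyLit σ) bs)

_∘ˢ_ : Subst → Subst → Subst
ρ ∘ˢ σ = subst (λ x → tm ρ (tm σ x)) (λ n p → pr ρ n (pr σ n p))

_≈ˢ_ : Subst → Subst → Set
σ ≈ˢ τ = (∀ x → tm σ x ≡ tm τ x) × (∀ n p → pr σ n p ≡ pr τ n p)

idˢ : Subst
idˢ = subst (λ x → x) (λ n p → p)

Unifier : Subst → Literal → Literal → Set
Unifier σ L M = applyLit σ L ≡ applyLit σ M

MGU : Subst → Literal → Literal → Set
MGU σ L M = Unifier σ L M × (∀ τ → Unifier τ L M → ∃[ ρ ] (τ ≈ˢ (ρ ∘ˢ σ)))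

Renaming : Subst → Set
Renaming σ = ∃[ τ ] ((τ ∘ˢ σ) ≈ˢ idˢ × (σ ∘ˢ τ) ≈ˢ idˢ)

_≅_ : Clause → Clause → Set
C ≅ D = (head C ≡ head D)
      × (∀ {L} → L ∈ body C → L ∈ body D)
      × (∀ {L} → L ∈ body D → L ∈ body C)

_≈ᶜ_ : Clause → Clause → Set
C ≈ᶜ D = ∃[ σ ] (Renaming σ × applyClause σ C ≅ D)

TmOcc : ℕ → Clause → Set
TmOcc x C = ∃[ L ] (L ∈ lits C × x ∈ args L)

PrOcc : ℕ → ℕ → Clause → Set
PrOcc n p C = ∃[ L ] (L ∈ lits C × pred L ≡ p × arity L ≡ n)

Apart : Clause → Clause → Set
Apart C D = (∀ x → TmOcc x C → TmOcc x D → ⊥)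
          × (∀ n p → PrOcc n p C → PrOcc n p D → ⊥)

WF : Clause → Set
WF C = All (λ L → 1 ≤ arity L) (lits C) × Unique (body C)

-- connected: the literals cannot be partitioned into two non-empty sets
-- whose (term) variable sets are disjoint.  A partition is a colouring
-- of the literal occurrences by Bool.
Connected : Clause → Set
Connected C =
  ¬ (Σ (Fin (length (lits C)) → Bool) λ f →
        (∃[ i ] (f i ≡ true))
      × (∃[ j ] (f j ≡ false))
      × (∀ i j x → f i ≡ true → f j ≡ false →
           x ∈ args (lookup (lits C) i) → x ∈ args (lookup (lits C) j) → ⊥))

TwoOcc : Clause → Set
TwoOcc C = ∀ x → TmOcc x C →
  ∃[ i ] ∃[ j ] (i ≢ j × x ∈ args (lookup (lits C) i)
                       × x ∈ args (lookup (lits C) j))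

Syn2c : Clause → Set
Syn2c C = WF C × Connected C × TwoOcc C

-- C is an instance of D by a variable unification (no literals merged:
-- the body of D is mapped onto the body of C as a multiset)
InstanceOf : Clause → Clause → Set
InstanceOf C D = ∃[ σ ] (applyHead σ (head D) ≡ head C
                         × map (applyLit σ) (body D) ↭ body C)

MostGeneral : Clause → Set
MostGeneral C = ∀ D → Syn2c D → InstanceOf C D → InstanceOf D C

H2c∞ : ℕ → Clause → Set
H2c∞ a C = Syn2c C × All (λ L → arity L ≤ a) (lits C) × MostGeneral C

H2c : ℕ → ℕ → Clause → Set
H2c a b C = H2c∞ a C × size C ≤ b

-- Standard resolution: binary resolution of a body literal of C₁
-- against the head of C₂ (renamed apart), followed by any number of
-- factoring steps (each unifying two body literals by an mgu).

data Resolvent (C₁ C₂ : Clause) : Clause → Set where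
  resolve : ∀ pre L post H σ →
    body C₁ ≡ pre ++ L ∷ post →
    head C₂ ≡ just H →
    MGU σ L H →
    Resolvent C₁ C₂
      (applyClause σ (clause (head C₁) (pre ++ post ++ body C₂)))

data Factor (D : Clause) : Clause → Set where
  factor : ∀ pre L₁ mid L₂ post σ →
    body D ≡ pre ++ L₁ ∷ mid ++ L₂ ∷ post →
    MGU σ L₁ L₂ →
    Factor D (applyClause σ (clause (head D) (pre ++ L₁ ∷ mid ++ post)))

data Factor* (D : Clause) : Clause → Set where
  done : Factor* D D
  step : ∀ {E F} → Factor D E → Factor* E F → Factor* D F

ConclusionOf : Clause → Clause → Clause → Set
ConclusionOf C₁ C₂ C =
  Apart C₁ C₂ ×
  ∃[ R ] ∃[ F ] (Resolvent C₁ C₂ R × Factor* R F × F ≈ᶜ C)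

{-# OPTIONS --safe #-}
-- Up to the names of its predicates, a clause of arity at most 2 is a multigraph with the
-- literals as edges. Being most general means that the predicates are distinct and that the
-- graph is rigid: no connected graph with all degrees ≥ 2 maps onto it without being injective
-- on variables; having at most three argument positions per variable suffices for this.
--
-- Whenever the literals split into two parts sharing at most two variables vs, resolving upon a
-- new literal L(vs) reduces the clause. If some variable v has four or more positions, rigidity
-- shows that moving two of its literals to a fresh variable disconnects the graph, which gives a
-- split sharing only v. Otherwise, if no two literals share at most two variables with the rest,
-- the graph is cubic and simple. Then take an edge g = ab (the head, if there is one), with
-- e, f the other edges at a and p, q those at b. The premises are the clause without e, f and the
-- clause without g, p, q, each with a new literal L(a); resolving upon L(a) and factoring
-- the common literals gives the clause back. If one of these premises is disconnected,
-- its components again yield a split along two variables.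
module Submission where

open import Defs
open import Data.Bool using (Bool; true; false)
import Data.Bool.Properties as Bool
open import Data.Empty using (⊥)
open import Data.Fin using (Fin; fromℕ<; toℕ)
open import Data.Fin.Properties using (toℕ-fromℕ<)
import Data.Fin.Properties as Fin
open import Data.Fin.Subset using (Subset)
open import Data.Fin.Subset.Properties using (anySubset?)
open import Data.List using (List; []; _∷_; _++_; map; length; concat; filter; lookup; deduplicate)
open import Data.List.Properties
  using (map-++; length-map; length-++; length-filter; filter-notAll; ∷-injective; ++-assoc;
         map-id; map-id-local; map-cong; map-cong-local; map-∘)
open import Data.List.Membership.Propositional using (_∈_; _∉_; find; lose)
open import Data.List.Membership.Propositional.Properties
open import Data.List.Relation.Unary.All as All using (All; []; _∷_)
import Data.List.Relation.Unary.All.Properties as All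
open import Data.List.Relation.Unary.AllPairs using ([]; _∷_)
open import Data.List.Relation.Unary.Any using (Any; here; there; any?)
import Data.List.Relation.Unary.Any.Properties as Any
open import Data.List.Relation.Unary.Unique.Propositional using (Unique)
import Data.List.Relation.Unary.Unique.Propositional.Properties as Unique
open import Data.List.Relation.Binary.Permutation.Propositional
  using (_↭_; refl; prep; swap; ↭-refl; ↭-sym; ↭-trans; ↭-reflexive; ↭⇒↭ₛ)
  renaming (trans to comp)
open import Data.List.Relation.Binary.Permutation.Propositional.Properties
  using (↭-map-inv; Any-resp-↭; All-resp-↭; ∈-resp-↭; map⁺; shift; shifts; ++-comm; drop-∷;
         ++⁺ʳ; ++⁺ˡ; ↭-length)
import Data.List.Relation.Binary.Permutation.Setoid.Properties as Setoid↭
open import Data.Maybe using (Maybe; just; nothing)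
open import Data.Nat using (ℕ; zero; suc; _+_; _∸_; _≤_; _<_; _≟_; _<?_; _≤?_; z≤n; s≤s; s≤s⁻¹)
open import Data.Nat.ListAction using (sum)
open import Data.Nat.Properties
open import Data.Product using (Σ; _×_; _,_; ∃₂; ∃-syntax; proj₁; proj₂)
open import Data.Product.Properties using (≡-dec)
open import Data.Sum using (_⊎_; inj₁; inj₂; [_,_]′)
import Data.Vec as Vec
import Data.Vec.Properties as Vec
open import Function using (_∘_; id; case_of_)
open import Relation.Binary.Definitions using (DecidableEquality)
open import Relation.Binary.PropositionalEquality
  using (_≡_; _≢_; refl; sym; trans; cong; cong₂; subst₂; setoid; module ≡-Reasoning)
  renaming (subst to transport)
open import Relation.Nullary using (¬_; Dec; yes; no; does; contradiction)
open import Relation.Nullary.Decidable using (_×-dec_; ¬?; decidable-stable; dec-true; dec-false)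
open import Data.List.Membership.DecPropositional _≟_ using (_∈?_)
open import Data.List.Membership.DecPropositional (≡-dec _≟_ _≟_) using () renaming (_∈?_ to _∈ₖ?_)
open import Data.List.Relation.Unary.Unique.DecPropositional.Properties _≟_ using (deduplicate-!)

-- Multigraphs

-- A literal of arity two can carry only two variables from one premise to the other, which settles
-- every clause with a separation along two variables. A cubic graph need not have one: taking out
-- the adjacent edges `e = au` and `f = aw` already cuts along `a`, `u` and `w`. Factoring gets
-- around this. If both premises contain a common literal at `u` and one at `w`, merging the two
-- copies of these literals identifies the variables, so the resolved literal has to carry only `a`.
-- The choice of common literals is constrained by the head `g` of the clause: it must stay out of
-- the second premise, whose head is the new literal. Keeping `p` and `q` there would then give that
-- premise as many body literals as the clause itself, and dropping just one of them would leave `b`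
-- in a single literal. Hence both go, and `b` disappears with them.

Graph : Set
Graph = List (List ℕ)

infix 4 _∈ᵥ_ _∉ᵥ_ _∈ᵥ?_

_∈ᵥ_ _∉ᵥ_ : ℕ → Graph → Set
x ∈ᵥ G = Any (x ∈_) G
x ∉ᵥ G = ¬ (x ∈ᵥ G)

_∈ᵥ?_ : ∀ x G → Dec (x ∈ᵥ G)
x ∈ᵥ? G = any? (x ∈?_) G

∈ᵥ-++⁻ : ∀ {x} G {H} → x ∈ᵥ G ++ H → x ∈ᵥ G ⊎ x ∈ᵥ H
∈ᵥ-++⁻ G = Any.++⁻ G

ind : ℕ → List ℕ → ℕ
ind x e with x ∈? e
... | yes _ = 1
... | no  _ = 0

cnt : ℕ → List ℕ → ℕ
cnt x []      = 0
cnt x (y ∷ e) with x ≟ y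
... | yes _ = suc (cnt x e)
... | no  _ = cnt x e

weight : (List ℕ → ℕ) → Graph → ℕ
weight w []      = 0
weight w (e ∷ G) = w e + weight w G

-- deg counts the literals containing a variable, occ its argument positions.
deg occ : ℕ → Graph → ℕ
deg x = weight (ind x)
occ x = weight (cnt x)

weight-++ : ∀ w G {H} → weight w (G ++ H) ≡ weight w G + weight w H
weight-++ w []          = refl
weight-++ w (e ∷ G) {H} = trans (cong (w e +_) (weight-++ w G)) (sym (+-assoc (w e) _ _))

weight-↭ : ∀ w {G H} → G ↭ H → weight w G ≡ weight w H
weight-↭ w refl       = refl
weight-↭ w (prep e p) = cong (w e +_) (weight-↭ w p)
weight-↭ w (swap {xs = G} {ys = H} e f p) = begin
  w e + (w f + weight w G) ≡⟨ cong (λ k → w e + (w f + k)) (weight-↭ w p) ⟩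
  w e + (w f + weight w H) ≡⟨ +-assoc (w e) _ _ ⟨
  w e + w f + weight w H   ≡⟨ cong (_+ weight w H) (+-comm (w e) (w f)) ⟩
  w f + w e + weight w H   ≡⟨ +-assoc (w f) _ _ ⟩
  w f + (w e + weight w H) ∎ where open ≡-Reasoning
weight-↭ w (comp p q) = trans (weight-↭ w p) (weight-↭ w q)

ind-∈ : ∀ {x e} → x ∈ e → ind x e ≡ 1
ind-∈ {x} {e} x∈e with x ∈? e
... | yes _  = refl
... | no x∉e = contradiction x∈e x∉e

ind-∉ : ∀ {x e} → x ∉ e → ind x e ≡ 0
ind-∉ {x} {e} x∉e with x ∈? e
... | yes x∈e = contradiction x∈e x∉e
... | no _    = refl

ind≤1 : ∀ x e → ind x e ≤ 1
ind≤1 x e with x ∈? e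
... | yes _ = ≤-refl
... | no _  = z≤n

ind≤ : ∀ {x y e f} → (x ∈ e → y ∈ f) → ind x e ≤ ind y f
ind≤ {x} {y} {e} {f} h with x ∈? e
... | yes x∈e = ≤-reflexive (sym (ind-∈ (h x∈e)))
... | no _    = z≤n

cnt-∈ : ∀ {x e} → x ∈ e → 1 ≤ cnt x e
cnt-∈ {x} {y ∷ e} x∈e with x ≟ y | x∈e
... | yes _  | _          = s≤s z≤n
... | no x≢y | here x≡y   = contradiction x≡y x≢y
... | no _   | there x∈e′ = cnt-∈ x∈e′

cnt-∉ : ∀ {x e} → x ∉ e → cnt x e ≡ 0
cnt-∉ {x} {[]}    _ = refl
cnt-∉ {x} {y ∷ e} x∉ with x ≟ y
... | yes refl = contradiction (here refl) x∉
... | no _     = cnt-∉ (x∉ ∘ there)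

cnt-unique : ∀ {x e} → Unique e → cnt x e ≤ 1
cnt-unique {x} {[]}    _ = z≤n
cnt-unique {x} {y ∷ e} (y∉ ∷ u) with x ≟ y
... | yes refl = s≤s (≤-reflexive (cnt-∉ (λ x∈e → All.lookup y∉ x∈e refl)))
... | no _     = cnt-unique u

cnt≤length : ∀ x e → cnt x e ≤ length e
cnt≤length x []      = z≤n
cnt≤length x (y ∷ e) with x ≟ y
... | yes _ = s≤s (cnt≤length x e)
... | no _  = m≤n⇒m≤1+n (cnt≤length x e)

ind≤cnt : ∀ x e → ind x e ≤ cnt x e
ind≤cnt x e with x ∈? e
... | yes x∈e = cnt-∈ x∈e
... | no _    = z≤n

weight-≤ : ∀ {v w} G → All (λ e → v e ≤ w e) G → weight v G ≤ weight w G
weight-≤ []      _        = z≤n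
weight-≤ (e ∷ G) (p ∷ ps) = +-mono-≤ p (weight-≤ G ps)

deg≤occ : ∀ x G → deg x G ≤ occ x G
deg≤occ x G = weight-≤ G (All.universal (ind≤cnt x) G)

deg≤length : ∀ x G → deg x G ≤ length G
deg≤length x []      = z≤n
deg≤length x (e ∷ G) = +-mono-≤ (ind≤1 x e) (deg≤length x G)

deg-∈ : ∀ {x G} → x ∈ᵥ G → 1 ≤ deg x G
deg-∈ {x} {e ∷ G} (here x∈e) = ≤-trans (≤-reflexive (sym (ind-∈ x∈e))) (m≤m+n _ _)
deg-∈ {x} {e ∷ G} (there p)  = ≤-trans (deg-∈ p) (m≤n+m _ _)

deg-∉ : ∀ {x G} → x ∉ᵥ G → deg x G ≡ 0
deg-∉ {x} {[]}    _ = refl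
deg-∉ {x} {e ∷ G} x∉ = cong₂ _+_ (ind-∉ (x∉ ∘ here)) (deg-∉ (x∉ ∘ there))

occ-∉ : ∀ {x G} → x ∉ᵥ G → occ x G ≡ 0
occ-∉ {x} {[]}    _ = refl
occ-∉ {x} {e ∷ G} x∉ = cong₂ _+_ (cnt-∉ (x∉ ∘ here)) (occ-∉ (x∉ ∘ there))

deg⇒∈ : ∀ {x} G → 1 ≤ deg x G → x ∈ᵥ G
deg⇒∈ {x} G 1≤ with x ∈ᵥ? G
... | yes p = p
... | no ¬p = contradiction (≤-trans 1≤ (≤-reflexive (deg-∉ ¬p))) λ ()

deg-skip : ∀ {x e} G → x ∉ e → deg x (e ∷ G) ≡ deg x G
deg-skip {x} G x∉e = cong (_+ deg x G) (ind-∉ x∉e)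

deg-hit : ∀ {x e} G → x ∈ e → deg x (e ∷ G) ≡ suc (deg x G)
deg-hit {x} G x∈e = cong (_+ deg x G) (ind-∈ x∈e)

deg-tail : ∀ {x n} e G → suc n ≤ deg x (e ∷ G) → n ≤ deg x G
deg-tail {x} e G h = s≤s⁻¹ (≤-trans h (+-monoˡ-≤ (deg x G) (ind≤1 x e)))

Two : Graph → Set
Two G = ∀ {x} → x ∈ᵥ G → 2 ≤ deg x G

MonoE : (ℕ → Bool) → List ℕ → Set
MonoE c e = ∀ x y → x ∈ e → y ∈ e → c x ≡ c y

Mono : (ℕ → Bool) → Graph → Set
Mono c G = All (MonoE c) G

-- Connectedness through colourings of the variables instead of the literals.
Conn : Graph → Set
Conn G = ∀ c → Mono c G → ∀ {x y} → x ∈ᵥ G → y ∈ᵥ G → c x ≡ c y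

-- Being most general, as far as term variables are concerned: `G′` is a candidate of which `G` is
-- an instance through `f`, and the instance may not unify any two of its variables.
Rigid : Graph → Set
Rigid G = ∀ G′ f → map (map f) G′ ≡ G → Two G′ → Conn G′ →
  ∀ {x y} → x ∈ᵥ G′ → y ∈ᵥ G′ → f x ≡ f y → x ≡ y

Two-↭ : ∀ {G H} → G ↭ H → Two G → Two H
Two-↭ p two x∈ = transport (2 ≤_) (weight-↭ _ p) (two (Any-resp-↭ (↭-sym p) x∈))

Conn-↭ : ∀ {G H} → G ↭ H → Conn G → Conn H
Conn-↭ p conn c m x∈ y∈ = conn c (All-resp-↭ (↭-sym p) m) (Any-resp-↭ (↭-sym p) x∈) (Any-resp-↭ (↭-sym p) y∈)

Rigid-↭ : ∀ {G H} → G ↭ H → Rigid G → Rigid H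
Rigid-↭ p rigid H′ f refl two conn x∈ y∈ with ↭-map-inv (map f) (↭-sym p)
... | G′ , eq , q = rigid G′ f (sym eq) (Two-↭ q two) (Conn-↭ q conn) (Any-resp-↭ q x∈) (Any-resp-↭ q y∈)

-- Distinct variables occupy disjoint sets of positions, and all of these become positions of the
-- common image.
cnt-map : ∀ f {x y} e → x ≢ y → f x ≡ f y → cnt x e + cnt y e ≤ cnt (f x) (map f e)
cnt-map f []      x≢y eq = z≤n
cnt-map f {x} {y} (z ∷ e) x≢y eq with x ≟ z | y ≟ z | f x ≟ f z
... | yes refl | yes refl | _      = contradiction refl x≢y
... | yes refl | no _     | yes _  = s≤s (cnt-map f e x≢y eq)
... | yes refl | no _     | no ≢   = contradiction refl ≢
... | no _     | yes refl | yes _  = ≤-trans (≤-reflexive (+-suc _ _)) (s≤s (cnt-map f e x≢y eq))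
... | no _     | yes refl | no ≢   = contradiction eq ≢
... | no _     | no _     | yes _  = m≤n⇒m≤1+n (cnt-map f e x≢y eq)
... | no _     | no _     | no _   = cnt-map f e x≢y eq

+-interchange : ∀ a b c d → (a + b) + (c + d) ≡ (a + c) + (b + d)
+-interchange a b c d = begin
  a + b + (c + d) ≡⟨ +-assoc a b _ ⟩
  a + (b + (c + d)) ≡⟨ cong (a +_) (+-assoc b c d) ⟨
  a + (b + c + d) ≡⟨ cong (λ k → a + (k + d)) (+-comm b c) ⟩
  a + (c + b + d) ≡⟨ cong (a +_) (+-assoc c b d) ⟩
  a + (c + (b + d)) ≡⟨ +-assoc a c _ ⟨
  a + c + (b + d) ∎ where open ≡-Reasoning

occ-map : ∀ f {x y} G → x ≢ y → f x ≡ f y → occ x G + occ y G ≤ occ (f x) (map (map f) G)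
occ-map f []      x≢y eq = z≤n
occ-map f {x} {y} (e ∷ G) x≢y eq = ≤-trans (≤-reflexive (+-interchange (cnt x e) _ _ _))
  (+-mono-≤ (cnt-map f e x≢y eq) (occ-map f G x≢y eq))

-- Two variables identified by f would together occupy at least four positions.
occ≤3⇒Rigid : ∀ {G} → (∀ x → occ x G ≤ 3) → Rigid G
occ≤3⇒Rigid occ≤3 G′ f refl two conn {x} {y} x∈ y∈ eq with x ≟ y
... | yes x≡y = x≡y
... | no x≢y = contradiction (≤-trans (≤-trans
    (+-mono-≤ (≤-trans (two x∈) (deg≤occ x G′)) (≤-trans (two y∈) (deg≤occ y G′)))
    (occ-map f G′ x≢y eq)) (occ≤3 (f x))) λ { (s≤s (s≤s (s≤s ()))) }

∈ᵥ-map⁺ : ∀ f {x G} → x ∈ᵥ G → f x ∈ᵥ map (map f) G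
∈ᵥ-map⁺ f (here p)  = here (∈-map⁺ f p)
∈ᵥ-map⁺ f (there p) = there (∈ᵥ-map⁺ f p)

∈ᵥ-map⁻ : ∀ f {y} G → y ∈ᵥ map (map f) G → ∃[ x ] (x ∈ᵥ G × y ≡ f x)
∈ᵥ-map⁻ f (e ∷ G) (here p)  with ∈-map⁻ f p
... | x , x∈ , eq = x , here x∈ , eq
∈ᵥ-map⁻ f (e ∷ G) (there p) with ∈ᵥ-map⁻ f G p
... | x , x∈ , eq = x , there x∈ , eq

deg-map : ∀ f x G → deg x G ≤ deg (f x) (map (map f) G)
deg-map f x []      = z≤n
deg-map f x (e ∷ G) = +-mono-≤ (ind≤ {x} {f x} {e} (∈-map⁺ f)) (deg-map f x G)

Two-map : ∀ f {G} → Two G → Two (map (map f) G)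
Two-map f {G} two y∈ with ∈ᵥ-map⁻ f G y∈
... | x , x∈ , refl = ≤-trans (two x∈) (deg-map f x G)

Mono-map : ∀ f c G → Mono c (map (map f) G) → Mono (c ∘ f) G
Mono-map f c G m = All.map (λ m x y x∈ y∈ → m (f x) (f y) (∈-map⁺ f x∈) (∈-map⁺ f y∈)) (All.map⁻ m)

Conn-map : ∀ f {G} → Conn G → Conn (map (map f) G)
Conn-map f {G} conn c m x∈ y∈ with ∈ᵥ-map⁻ f G x∈ | ∈ᵥ-map⁻ f G y∈
... | x , x∈′ , refl | y , y∈′ , refl = conn (c ∘ f) (Mono-map f c G m) x∈′ y∈′

map-map-∘ : ∀ (f g : ℕ → ℕ) G → map (map f) (map (map g) G) ≡ map (map (f ∘ g)) G
map-map-∘ f g G = trans (sym (map-∘ G)) (map-cong (λ e → sym (map-∘ e)) G)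

map-map-id : ∀ (f : ℕ → ℕ) G → (∀ {x} → x ∈ᵥ G → f x ≡ x) → map (map f) G ≡ G
map-map-id f []      h = refl
map-map-id f (e ∷ G) h = cong₂ _∷_ (map-id-local (All.tabulate (h ∘ here))) (map-map-id f G (h ∘ there))

Rigid-map : ∀ ι π {G} → (∀ x → π (ι x) ≡ x) → Rigid G → Rigid (map (map ι) G)
Rigid-map ι π {G} inv rigid G′ f eq two conn x∈ y∈ fx≡fy =
  rigid G′ (π ∘ f) eq′ two conn x∈ y∈ (cong π fx≡fy)
  where
  eq′ : map (map (π ∘ f)) G′ ≡ G
  eq′ = trans (sym (map-map-∘ π f G′)) (trans (cong (map (map π)) eq)
          (trans (map-map-∘ π ι G) (map-map-id (π ∘ ι) G (λ {x} _ → inv x))))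

-- A crude strict upper bound on the entries, used throughout as a source of fresh names.
bound : List ℕ → ℕ
bound xs = suc (sum xs)

<-bound : ∀ {x xs} → x ∈ xs → x < bound xs
<-bound {xs = x ∷ xs} (here refl) = s≤s (m≤m+n x _)
<-bound {xs = y ∷ xs} (there p)   = ≤-trans (<-bound p) (s≤s (m≤n+m _ y))

-- Deciding connectedness

Broken : (ℕ → Bool) → Graph → Set
Broken c G = Mono c G × ∃₂ λ x y → x ∈ᵥ G × y ∈ᵥ G × c x ≢ c y

module _ (G : Graph) where

  private
    V = concat G
    N = bound V

    colour : Subset N → ℕ → Bool
    colour S x with x <? N
    ... | yes x<N = Vec.lookup S (fromℕ< x<N)
    ... | no _    = true

    colour-tabulate : ∀ c {x} → x ∈ᵥ G → colour (Vec.tabulate (c ∘ toℕ)) x ≡ c x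
    colour-tabulate c {x} x∈ with x <? N
    ... | yes x<N = trans (Vec.lookup∘tabulate (c ∘ toℕ) (fromℕ< x<N)) (cong c (toℕ-fromℕ< x<N))
    ... | no x≮N  = contradiction (<-bound (∈-concat⁺ x∈)) x≮N

    Const : (ℕ → Bool) → List ℕ → Set
    Const c e = All (λ x → All (λ y → c x ≡ c y) e) e

    const? : ∀ c e → Dec (Const c e)
    const? c e = All.all? (λ x → All.all? (λ y → c x Bool.≟ c y) e) e

    toMonoE : ∀ c {e} → Const c e → MonoE c e
    toMonoE c a _ _ x∈ y∈ = All.lookup (All.lookup a x∈) y∈

    fromMonoE : ∀ c {e} → MonoE c e → Const c e
    fromMonoE c m = All.tabulate λ x∈ → All.tabulate λ y∈ → m _ _ x∈ y∈

  -- Only the colours of variables below `N` matter, so the search runs through the finitely many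
  -- subsets of `Fin N` instead of all colourings of the natural numbers.
  conn? : Conn G ⊎ ∃[ c ] Broken c G
  conn? with anySubset? {P = λ S → All (Const (colour S)) G × ¬ Const (colour S) V}
               (λ S → All.all? (const? (colour S)) G ×-dec ¬? (const? (colour S) V))
  ... | yes (S , mono , ¬const) = inj₂ (c , All.map (toMonoE c) mono , diff)
    where
    c = colour S
    diff : ∃₂ λ x y → x ∈ᵥ G × y ∈ᵥ G × c x ≢ c y
    diff with find (All.¬All⇒Any¬ (λ x → All.all? (λ y → c x Bool.≟ c y) V) V ¬const)
    ... | x , x∈ , ¬all with find (All.¬All⇒Any¬ (λ y → c x Bool.≟ c y) V ¬all)
    ... | y , y∈ , ne = x , y , ∈-concat⁻ G x∈ , ∈-concat⁻ G y∈ , ne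
  ... | no ¬broken = inj₁ conn
    where
    conn : Conn G
    conn c m {x} {y} x∈ y∈ = decidable-stable (c x Bool.≟ c y) λ ne →
      ¬broken (Vec.tabulate (c ∘ toℕ) ,
        All.tabulate (λ e∈ → fromMonoE (colour (Vec.tabulate (c ∘ toℕ))) λ a b a∈ b∈ →
          subst₂ _≡_ (sym (colour-tabulate c (lose e∈ a∈))) (sym (colour-tabulate c (lose e∈ b∈)))
            (All.lookup m e∈ a b a∈ b∈)) ,
        λ all → ne (subst₂ _≡_ (colour-tabulate c x∈) (colour-tabulate c y∈)
          (All.lookup (All.lookup all (∈-concat⁺ x∈)) (∈-concat⁺ y∈))))

-- Cutting and gluing along shared variables

record Shared (vs : List ℕ) (G H : Graph) : Set where
  field
    left     : ∀ {x} → x ∈ vs → x ∈ᵥ G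
    right    : ∀ {x} → x ∈ vs → x ∈ᵥ H
    complete : ∀ {x} → x ∈ᵥ G → x ∈ᵥ H → x ∈ vs
open Shared public

Shared-sym : ∀ {vs G H} → Shared vs G H → Shared vs H G
Shared-sym s = record { left = right s ; right = left s ; complete = λ p q → complete s q p }

module _ {vs G H} (sh : Shared vs G H) where

  ∈ᵥ-side : ∀ {x} → x ∈ᵥ vs ∷ G → x ∈ᵥ G
  ∈ᵥ-side (here x∈)  = left sh x∈
  ∈ᵥ-side (there x∈) = x∈

  -- A colouring of vs ∷ G extends to G ++ H by giving H the colour of vs.
  Conn-side : ∀ {v} → v ∈ vs → Conn (G ++ H) → Conn (vs ∷ G)
  Conn-side {v} v∈ conn c (mvs ∷ m) {x} {y} x∈ y∈ =
    subst₂ _≡_ (ext-G (∈ᵥ-side x∈)) (ext-G (∈ᵥ-side y∈))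
      (conn ext (All.++⁺ monoG monoH) (Any.++⁺ˡ (∈ᵥ-side x∈)) (Any.++⁺ˡ (∈ᵥ-side y∈)))
    where
    ext : ℕ → Bool
    ext z with z ∈ᵥ? G
    ... | yes _ = c z
    ... | no _  = c v
    ext-G : ∀ {z} → z ∈ᵥ G → ext z ≡ c z
    ext-G {z} z∈ with z ∈ᵥ? G
    ... | yes _ = refl
    ... | no ∉  = contradiction z∈ ∉
    ext-H : ∀ {z} → z ∈ᵥ H → ext z ≡ c v
    ext-H {z} z∈ with z ∈ᵥ? G
    ... | yes z∈G = mvs z v (complete sh z∈G z∈) v∈
    ... | no _    = refl
    monoG : Mono ext G
    monoG = All.tabulate λ e∈ a b a∈ b∈ → subst₂ _≡_ (sym (ext-G (lose e∈ a∈))) (sym (ext-G (lose e∈ b∈)))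
                                            (All.lookup m e∈ a b a∈ b∈)
    monoH : Mono ext H
    monoH = All.tabulate λ e∈ a b a∈ b∈ → trans (ext-H (lose e∈ a∈)) (sym (ext-H (lose e∈ b∈)))

  -- A shared variable lies in `vs` and in a literal of `G`; any other variable of `G` is absent
  -- from `H` and so keeps all its literals.
  Two-side : Two (G ++ H) → Two (vs ∷ G)
  Two-side two {x} x∈ with x ∈? vs
  ... | yes x∈vs = s≤s (deg-∈ (left sh x∈vs))
  ... | no x∉vs  = ≤-trans (two (Any.++⁺ˡ (∈ᵥ-side x∈))) (≤-reflexive eq)
    where
    eq : deg x (G ++ H) ≡ deg x G
    eq = trans (weight-++ (ind x) G) (trans (cong (deg x G +_)
           (deg-∉ (x∉vs ∘ complete sh (∈ᵥ-side x∈)))) (+-identityʳ _))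

  -- The one position that `vs` adds at a shared variable is paid for by a position lost with `H`.
  occ-side : Unique vs → ∀ x → occ x (G ++ H) ≤ 3 → occ x (vs ∷ G) ≤ 3
  occ-side u x occ≤3 with x ∈? vs
  ... | no x∉vs  = ≤-trans (≤-reflexive (cong (_+ occ x G) (cnt-∉ x∉vs)))
                     (≤-trans (m≤m+n _ _) (≤-trans (≤-reflexive (sym (weight-++ (cnt x) G))) occ≤3))
  ... | yes x∈vs = begin
    cnt x vs + occ x G  ≤⟨ +-monoˡ-≤ (occ x G) (≤-trans (cnt-unique u) (≤-trans (deg-∈ (right sh x∈vs)) (deg≤occ x H))) ⟩
    occ x H + occ x G   ≡⟨ +-comm (occ x H) _ ⟩
    occ x G + occ x H   ≡⟨ weight-++ (cnt x) G ⟨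
    occ x (G ++ H)      ≤⟨ occ≤3 ⟩
    3                   ∎ where open ≤-Reasoning

-- A graph mapping onto G plus a unary literal at the cut variable v is completed
-- to one mapping onto G ++ H by gluing a fresh copy of H at the preimage of v.
Rigid-side : ∀ {v G H} → Shared (v ∷ []) G H → Conn (G ++ H) → Two (G ++ H) →
  Rigid (G ++ H) → Rigid ((v ∷ []) ∷ G)
Rigid-side {v} {G} {H} sh conn two rigid (((v′ ∷ []) ∷ G′)) f refl two′ conn′ {x} {y} x∈ y∈ fx≡fy =
  rigid G⁺ f⁺ map-f⁺ two⁺ conn⁺ (Any.++⁺ˡ (G′∋ x∈)) (Any.++⁺ˡ (G′∋ y∈))
    (trans (f⁺-low (<-bound (∈-concat⁺ x∈))) (trans fx≡fy (sym (f⁺-low (<-bound (∈-concat⁺ y∈))))))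
  where
  K = bound (concat ((v′ ∷ []) ∷ G′))

  <K : ∀ {z} → z ∈ᵥ (v′ ∷ []) ∷ G′ → z < K
  <K z∈ = <-bound (∈-concat⁺ z∈)

  -- `v` is glued to its preimage `v′`; all other variables are shifted past those of `G′`, so the
  -- copy of `H` meets `G′` at most in `v′`.
  φ : ℕ → ℕ
  φ z with z ≟ v
  ... | yes _ = v′
  ... | no _  = K + z

  φ-v : φ v ≡ v′
  φ-v with v ≟ v
  ... | yes _  = refl
  ... | no v≢v = contradiction refl v≢v

  -- Below `K` this is `f`, above it the inverse shift. It undoes `φ`, also at `v`, because `f v′`
  -- is `v`.
  f⁺ : ℕ → ℕ
  f⁺ z with z <? K
  ... | yes _ = f z
  ... | no _  = z ∸ K

  f⁺-low : ∀ {z} → z < K → f⁺ z ≡ f z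
  f⁺-low {z} z<K with z <? K
  ... | yes _  = refl
  ... | no z≮K = contradiction z<K z≮K

  f⁺-φ : ∀ z → f⁺ (φ z) ≡ z
  f⁺-φ z with z ≟ v
  ... | yes refl = f⁺-low (<K (here (here refl)))
  ... | no _ with K + z <? K
  ...   | yes K+z<K = contradiction (≤-trans (s≤s (m≤m+n K z)) K+z<K) (n≮n K)
  ...   | no _      = m+n∸m≡n K z

  φH = map (map φ) H
  G⁺ = G′ ++ φH

  -- The unary literal accounts for only one of the two literals that contain `v′`.
  v′∈G′ : v′ ∈ᵥ G′
  v′∈G′ = deg⇒∈ G′ (deg-tail (v′ ∷ []) G′ (two′ (here (here refl))))

  G′∋ : ∀ {z} → z ∈ᵥ (v′ ∷ []) ∷ G′ → z ∈ᵥ G′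
  G′∋ (here (here refl)) = v′∈G′
  G′∋ (there p)          = p

  map-f⁺ : map (map f⁺) G⁺ ≡ map (map f) G′ ++ H
  map-f⁺ = trans (map-++ (map f⁺) G′ φH) (cong₂ _++_
    (map-cong-local (All.tabulate λ e∈ → map-cong-local (All.tabulate λ z∈ → f⁺-low (<K (there (lose e∈ z∈))))))
    (trans (map-map-∘ f⁺ φ H) (map-map-id (f⁺ ∘ φ) H λ {z} _ → f⁺-φ z)))

  two⁺ : Two G⁺
  two⁺ {z} z∈ with z ≟ v′
  ... | yes refl = ≤-trans (+-mono-≤ (deg-∈ v′∈G′)
          (≤-trans (deg-∈ (transport (_∈ᵥ φH) φ-v (∈ᵥ-map⁺ φ (right sh (here refl))))) ≤-refl))
          (≤-reflexive (sym (weight-++ (ind v′) G′)))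
  ... | no z≢v′ with ∈ᵥ-++⁻ G′ z∈
  ...   | inj₁ z∈G′ = ≤-trans (two′ (there z∈G′)) (≤-trans
          (≤-reflexive (deg-skip G′ λ { (here z≡v′) → z≢v′ z≡v′ }))
          (≤-trans (m≤m+n _ _) (≤-reflexive (sym (weight-++ (ind z) G′)))))
  ...   | inj₂ z∈φH with ∈ᵥ-map⁻ φ H z∈φH
  ...     | u , u∈H , refl = ≤-trans (two (Any.++⁺ʳ _ u∈H)) (≤-trans
          (≤-reflexive (trans (weight-++ (ind u) G) (cong (_+ deg u H) (deg-∉ u∉G))))
          (≤-trans (deg-map φ u H) (≤-trans (m≤n+m _ _) (≤-reflexive (sym (weight-++ (ind (φ u)) G′))))))
    where
    u∉G : u ∉ᵥ G
    u∉G u∈G with complete sh u∈G u∈H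
    ... | here refl = z≢v′ φ-v

  conn⁺ : Conn G⁺
  conn⁺ c m p q = trans (to-v′ p) (sym (to-v′ q))
    where
    m′ : Mono c G′
    m′ = All.++⁻ˡ G′ m
    mH : Mono (c ∘ φ) H
    mH = Mono-map φ c H (All.++⁻ʳ G′ m)
    connH : Conn ((v ∷ []) ∷ H)
    connH = Conn-side (Shared-sym sh) (here refl) (Conn-↭ (++-comm G H) conn)
    single : ∀ {c u} → MonoE c (u ∷ [])
    single _ _ (here refl) (here refl) = refl
    to-v′ : ∀ {z} → z ∈ᵥ G⁺ → c z ≡ c v′
    to-v′ z∈ with ∈ᵥ-++⁻ G′ z∈
    ... | inj₁ z∈G′ = conn′ c (single ∷ m′) (there z∈G′) (here (here refl))
    ... | inj₂ z∈φH with ∈ᵥ-map⁻ φ H z∈φH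
    ...   | u , u∈H , refl = trans (connH (c ∘ φ) (single ∷ mH) (there u∈H) (here (here refl))) (cong c φ-v)

-- Splitting a variable in two

record SplitAt (v w : ℕ) (f : ℕ → ℕ) (e : List ℕ) : Set where
  field
    edge   : List ℕ
    map≡   : map f edge ≡ e
    fresh∈ : w ∈ edge
    ⊆      : ∀ {z} → z ∈ edge → z ≢ w → z ∈ e
    ⊇      : ∀ {z} → z ∈ e → z ≢ v → z ∈ edge
    count  : cnt v e ≤ suc (cnt v edge)
open SplitAt public

module Split (v w : ℕ) where

  merge : ℕ → ℕ
  merge z with z ≟ w
  ... | yes _ = v
  ... | no _  = z

  merge-w : merge w ≡ v
  merge-w with w ≟ w
  ... | yes _  = refl
  ... | no w≢w = contradiction refl w≢w

  merge-≢ : ∀ {z} → z ≢ w → merge z ≡ z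
  merge-≢ {z} z≢w with z ≟ w
  ... | yes z≡w = contradiction z≡w z≢w
  ... | no _    = refl

  -- Only the first position of `v` is moved to `w`, so a loop keeps one end at `v`; this is what
  -- `count` records.
  split-at : ∀ {e} → v ∈ e → w ∉ e → SplitAt v w merge e
  split-at {v ∷ e} (here refl) w∉ = record
    { edge   = w ∷ e
    ; map≡   = cong₂ _∷_ merge-w (map-id-local (All.tabulate λ z∈ → merge-≢ λ { refl → w∉ (there z∈) }))
    ; fresh∈ = here refl
    ; ⊆      = λ { (here z≡w) z≢w → contradiction z≡w z≢w ; (there z∈) _ → there z∈ }
    ; ⊇      = λ { (here z≡v) z≢v → contradiction z≡v z≢v ; (there z∈) _ → there z∈ }
    ; count  = count′
    }
    where
    count′ : cnt v (v ∷ e) ≤ suc (cnt v (w ∷ e))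
    count′ with v ≟ v | v ≟ w
    ... | yes _ | yes _ = m≤n⇒m≤1+n ≤-refl
    ... | yes _ | no _  = ≤-refl
    ... | no ≢  | _     = contradiction refl ≢
  split-at {u ∷ e} (there v∈) w∉ = record
    { edge   = u ∷ edge s
    ; map≡   = cong₂ _∷_ (merge-≢ λ { refl → w∉ (here refl) }) (map≡ s)
    ; fresh∈ = there (fresh∈ s)
    ; ⊆      = λ { (here z≡u) _ → here z≡u ; (there z∈) z≢w → there (⊆ s z∈ z≢w) }
    ; ⊇      = λ { (here z≡u) _ → here z≡u ; (there z∈) z≢v → there (⊇ s z∈ z≢v) }
    ; count  = count′
    }
    where
    s = split-at v∈ (w∉ ∘ there)
    count′ : cnt v (u ∷ e) ≤ suc (cnt v (u ∷ edge s))
    count′ with v ≟ u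
    ... | yes _ = s≤s (count s)
    ... | no _  = count s

-- Guarantees that `v` still lies in two literals after one of its positions in each of `e` and `f`
-- has been moved: either two further literals contain it, or `e` is a loop that keeps an end,
-- together with another such loop or a further literal.
Heavy : ℕ → List ℕ → List ℕ → Graph → Set
Heavy v e f R = 2 ≤ deg v R ⊎ (2 ≤ cnt v e × (2 ≤ cnt v f ⊎ v ∈ᵥ R))

-- `β` is the colour of the fresh variable. The other variables of `e` and `f` lie on its side,
-- while `v` lies on the opposite side with at least two literals of `R`.
record Cut (v : ℕ) (e f : List ℕ) (R : Graph) : Set where
  field
    colour : ℕ → Bool
    β      : Bool
    mono   : Mono colour R
    v≢     : colour v ≢ β
    branch : ∀ {z} → z ∈ e ⊎ z ∈ f → z ≢ v → colour z ≡ β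
    heavy  : 2 ≤ deg v R

-- Moving e and f from v to a fresh variable w must disconnect a rigid graph.
rigid⇒cut : ∀ {v e f R} → Conn (e ∷ f ∷ R) → Two (e ∷ f ∷ R) → Rigid (e ∷ f ∷ R) →
  v ∈ e → v ∈ f → Heavy v e f R → Cut v e f R
rigid⇒cut {v} {e} {f} {R} conn two rigid v∈e v∈f hv = result
  where
  G = e ∷ f ∷ R
  w = bound (concat G)

  w∉G : w ∉ᵥ G
  w∉G w∈ = n≮n w (<-bound (∈-concat⁺ w∈))

  v≢w : v ≢ w
  v≢w v≡w = w∉G (here (transport (_∈ e) v≡w v∈e))

  open Split v w

  se = split-at v∈e (w∉G ∘ here)
  sf = split-at v∈f (w∉G ∘ there ∘ here)
  e′ = edge se
  f′ = edge sf
  G′ = e′ ∷ f′ ∷ R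

  v∈split : ∀ {h} (s : SplitAt v w merge h) → 2 ≤ cnt v h → v ∈ edge s
  v∈split s 2≤ with v ∈? edge s
  ... | yes p = p
  ... | no ¬p = contradiction (≤-trans 2≤ (≤-trans (count s) (≤-reflexive (cong suc (cnt-∉ ¬p))))) λ { (s≤s ()) }

  heavy-split : Heavy v e f R → 2 ≤ deg v G′
  heavy-split (inj₁ 2≤R) = ≤-trans 2≤R (≤-trans (m≤n+m (deg v R) (ind v f′)) (m≤n+m _ (ind v e′)))
  heavy-split (inj₂ (2≤e , inj₁ 2≤f)) = ≤-trans (s≤s (s≤s z≤n)) (≤-reflexive (sym
    (trans (deg-hit (f′ ∷ R) (v∈split se 2≤e)) (cong suc (deg-hit R (v∈split sf 2≤f))))))
  heavy-split (inj₂ (2≤e , inj₂ v∈R)) = ≤-trans (s≤s (≤-trans (deg-∈ v∈R) (m≤n+m _ _)))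
    (≤-reflexive (sym (deg-hit (f′ ∷ R) (v∈split se 2≤e))))

  deg-v : 2 ≤ deg v G′
  deg-v = heavy-split hv

  two′ : Two G′
  two′ {z} z∈ with z ≟ w | z ≟ v
  ... | yes refl | _        = ≤-trans (s≤s (s≤s z≤n)) (≤-reflexive (sym
          (trans (deg-hit (f′ ∷ R) (fresh∈ se)) (cong suc (deg-hit R (fresh∈ sf))))))
  ... | no _     | yes refl = deg-v
  ... | no z≢w   | no z≢v   = ≤-trans (two (back z∈))
          (+-mono-≤ (ind≤ {z} {z} {e} {e′} λ p → ⊇ se p z≢v)
            (+-monoˡ-≤ (deg z R) (ind≤ {z} {z} {f} {f′} λ p → ⊇ sf p z≢v)))
    where
    back : z ∈ᵥ G′ → z ∈ᵥ G
    back (here p)          = here (⊆ se p z≢w)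
    back (there (here p))  = there (here (⊆ sf p z≢w))
    back (there (there p)) = there (there p)

  v∈G′ : v ∈ᵥ G′
  v∈G′ = deg⇒∈ G′ (≤-trans (s≤s z≤n) deg-v)

  merge-G′ : map (map merge) G′ ≡ G
  merge-G′ = cong₂ _∷_ (map≡ se) (cong₂ _∷_ (map≡ sf)
    (map-map-id merge R λ z∈ → merge-≢ λ { refl → w∉G (there (there z∈)) }))

  forward : ∀ c {z} → c v ≡ c w → z ∈ᵥ G′ → ∃[ u ] (u ∈ᵥ G × c z ≡ c u)
  forward c {z} eq z∈ with z ≟ w
  ... | yes refl = v , here v∈e , sym eq
  forward c eq (here p)          | no z≢w = _ , here (⊆ se p z≢w) , refl
  forward c eq (there (here p))  | no z≢w = _ , there (here (⊆ sf p z≢w)) , refl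
  forward c eq (there (there p)) | no z≢w = _ , there (there p) , refl

  mono-split : ∀ c {h} (s : SplitAt v w merge h) → c v ≡ c w → MonoE c (edge s) → MonoE c h
  mono-split c {h} s eq m x y x∈ y∈ = trans (to-w x x∈) (sym (to-w y y∈))
    where
    to-w : ∀ z → z ∈ h → c z ≡ c w
    to-w z z∈ with z ≟ v
    ... | yes refl = eq
    ... | no z≢v   = m z w (⊇ s z∈ z≢v) (fresh∈ s)

  result : Cut v e f R
  result with conn? G′
  -- Were the split graph connected, merging `w` back into `v` would map it onto `G` and identify
  -- two variables, against rigidity.
  ... | inj₁ conn′ = contradiction
          (rigid G′ merge merge-G′ two′ conn′ v∈G′ (here (fresh∈ se)) (trans (merge-≢ v≢w) (sym merge-w)))
          v≢w
  ... | inj₂ (c , (me ∷ mf ∷ mR) , x , y , x∈ , y∈ , cx≢cy) with c v Bool.≟ c w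
  -- If `v` and `w` have the same colour, the colouring descends to `G`, which is connected.
  ...   | yes eq with forward c eq x∈ | forward c eq y∈
  ...     | x′ , x′∈ , ex | y′ , y′∈ , ey = contradiction
              (trans ex (trans (conn c (mono-split c se eq me ∷ mono-split c sf eq mf ∷ mR) x′∈ y′∈) (sym ey))) cx≢cy
  result | inj₂ (c , (me ∷ mf ∷ mR) , _) | no cv≢cw = record
    { colour = c ; β = c w ; mono = mR ; v≢ = cv≢cw
    ; branch = λ { (inj₁ z∈) z≢v → me _ w (⊇ se z∈ z≢v) (fresh∈ se)
                 ; (inj₂ z∈) z≢v → mf _ w (⊇ sf z∈ z≢v) (fresh∈ sf) }
    -- Since `v` and `w` differ in colour, neither split literal contains `v` any more, so the two
    -- literals at `v` are found in `R`.
    ; heavy  = ≤-trans deg-v (≤-reflexive (trans (deg-skip (f′ ∷ R) (v∉ se me)) (deg-skip R (v∉ sf mf))))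
    }
    where
    v∉ : ∀ {h} (s : SplitAt v w merge h) → MonoE c (edge s) → v ∉ edge s
    v∉ s m v∈ = cv≢cw (m v w v∈ (fresh∈ s))

-- Clauses as multigraphs

edges : List Literal → Graph
edges = map args

key : Literal → ℕ × ℕ
key l = arity l , pred l

-- The fragment in terms of literals alone. Polarity enters none of the conditions, so literals can
-- be rearranged freely between head and body.
record Good (ls : List Literal) : Set where
  field
    arity≥1 : All (λ l → 1 ≤ arity l) ls
    arity≤2 : All (λ l → arity l ≤ 2) ls
    keys!   : Unique (map key ls)
    conn    : Conn (edges ls)
    two     : Two (edges ls)
    rigid   : Rigid (edges ls)

∈ᵥ-index : ∀ {x} ls → x ∈ᵥ edges ls → ∃[ i ] x ∈ args (lookup ls i)
∈ᵥ-index (l ∷ ls) (here p)  = Fin.zero , p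
∈ᵥ-index (l ∷ ls) (there p) with ∈ᵥ-index ls p
... | i , q = Fin.suc i , q

index-∈ᵥ : ∀ {x} ls i → x ∈ args (lookup ls i) → x ∈ᵥ edges ls
index-∈ᵥ (l ∷ ls) Fin.zero    p = here p
index-∈ᵥ (l ∷ ls) (Fin.suc i) p = there (index-∈ᵥ ls i p)

-- A literal whose variables all have one colour inherits it, and the comparison with `c x` makes
-- the side of `x` the true one.
Connected⇒Conn : ∀ C → Connected C → Conn (edges (lits C))
Connected⇒Conn C connected c m {x} {y} x∈ y∈ = decidable-stable (c x Bool.≟ c y) λ ne →
  connected (colour , (proj₁ ix , trans (colour-at ix) (dec-true (c x Bool.≟ c x) refl))
                    , (proj₁ iy , trans (colour-at iy) (dec-false (c y Bool.≟ c x) (ne ∘ sym)))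
                    , λ i j z ti fj z∈i z∈j → case trans (sym ti) (trans (colour-at (i , z∈i))
                        (trans (sym (colour-at (j , z∈j))) fj)) of λ ())
  where
  ls = lits C
  first : List ℕ → Bool
  -- A literal without arguments contains no variable, so any default colour would do.
  first []      = true
  first (z ∷ _) = c z
  colour : Fin (length ls) → Bool
  colour i = does (first (args (lookup ls i)) Bool.≟ c x)
  first≡ : ∀ {e z} → MonoE c e → z ∈ e → first e ≡ c z
  first≡ {_ ∷ _} me z∈ = me _ _ (here refl) z∈
  monoAt : ∀ ls → Mono c (edges ls) → ∀ i → MonoE c (args (lookup ls i))
  monoAt (l ∷ ls) (ml ∷ _) Fin.zero    = ml
  monoAt (l ∷ ls) (_ ∷ ms) (Fin.suc i) = monoAt ls ms i
  colour-at : ∀ {z} (i : ∃[ i ] z ∈ args (lookup ls i)) → colour (proj₁ i) ≡ does (c z Bool.≟ c x)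
  colour-at (i , z∈) = cong (λ b → does (b Bool.≟ c x)) (first≡ (monoAt ls m i) z∈)
  ix = ∈ᵥ-index ls x∈
  iy = ∈ᵥ-index ls y∈

-- A variable is coloured true when a literal on the true side contains it; by disjointness no
-- literal on the false side does. Positive arities ensure that both sides contribute a variable.
Conn⇒Connected : ∀ C → All (λ l → 1 ≤ arity l) (lits C) → Conn (edges (lits C)) → Connected C
Conn⇒Connected C ne conn (f , (i , fi) , (j , fj) , disj) =
  case trans (sym (c-true i fi (first i)))
    (trans (conn c mono (index-∈ᵥ ls i (first i)) (index-∈ᵥ ls j (first j))) (c-false j fj (first j))) of λ ()
  where
  ls = lits C
  c? : ∀ x → Dec (∃[ i ] (f i ≡ true × x ∈ args (lookup ls i)))
  c? x = Fin.any? λ i → (f i Bool.≟ true) ×-dec (x ∈? args (lookup ls i))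
  c : ℕ → Bool
  c x = does (c? x)
  c-true : ∀ k → f k ≡ true → ∀ {x} → x ∈ args (lookup ls k) → c x ≡ true
  c-true k fk x∈ = dec-true (c? _) (k , fk , x∈)
  c-false : ∀ k → f k ≡ false → ∀ {x} → x ∈ args (lookup ls k) → c x ≡ false
  c-false k fk x∈ = dec-false (c? _) λ { (l , fl , x∈l) → disj l k _ fl fk x∈l x∈ }
  someElement : ∀ {e : List ℕ} → 1 ≤ length e → ∃[ x ] x ∈ e
  someElement {x ∷ _} _ = x , here refl
  firstAt : ∀ k → ∃[ x ] x ∈ args (lookup ls k)
  firstAt k = someElement (All.lookup ne (∈-lookup k))
  first : ∀ k → proj₁ (firstAt k) ∈ args (lookup ls k)
  first k = proj₂ (firstAt k)
  monoAt : ∀ ls → (∀ i → MonoE c (args (lookup ls i))) → Mono c (edges ls)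
  monoAt []       h = []
  monoAt (l ∷ ls) h = h Fin.zero ∷ monoAt ls (h ∘ Fin.suc)
  mono : Mono c (edges ls)
  mono = monoAt ls λ k x y x∈ y∈ → at k (f k) refl x∈ y∈
    where
    at : ∀ k b → f k ≡ b → ∀ {x y} → x ∈ args (lookup ls k) → y ∈ args (lookup ls k) → c x ≡ c y
    at k true  fk x∈ y∈ = trans (c-true k fk x∈) (sym (c-true k fk y∈))
    at k false fk x∈ y∈ = trans (c-false k fk x∈) (sym (c-false k fk y∈))

∈-literal⇒∈ᵥ : ∀ {x l ls} → l ∈ ls → x ∈ args l → x ∈ᵥ edges ls
∈-literal⇒∈ᵥ (here refl) x∈ = here x∈
∈-literal⇒∈ᵥ (there l∈)  x∈ = there (∈-literal⇒∈ᵥ l∈ x∈)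

∈ᵥ⇒∈-literal : ∀ {x} ls → x ∈ᵥ edges ls → ∃[ l ] (l ∈ ls × x ∈ args l)
∈ᵥ⇒∈-literal (l ∷ ls) (here x∈) = l , here refl , x∈
∈ᵥ⇒∈-literal (l ∷ ls) (there p) with ∈ᵥ⇒∈-literal ls p
... | l′ , l′∈ , x∈ = l′ , there l′∈ , x∈

two-indices⇒deg : ∀ {x} ls i j → i ≢ j → x ∈ args (lookup ls i) → x ∈ args (lookup ls j) → 2 ≤ deg x (edges ls)
two-indices⇒deg (l ∷ ls) Fin.zero    Fin.zero    i≢j _ _ = contradiction refl i≢j
two-indices⇒deg (l ∷ ls) Fin.zero    (Fin.suc j) _ p q =
  ≤-trans (s≤s (deg-∈ (index-∈ᵥ ls j q))) (≤-reflexive (sym (deg-hit (edges ls) p)))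
two-indices⇒deg (l ∷ ls) (Fin.suc i) Fin.zero    _ p q =
  ≤-trans (s≤s (deg-∈ (index-∈ᵥ ls i p))) (≤-reflexive (sym (deg-hit (edges ls) q)))
two-indices⇒deg (l ∷ ls) (Fin.suc i) (Fin.suc j) i≢j p q =
  ≤-trans (two-indices⇒deg ls i j (i≢j ∘ cong Fin.suc) p q) (m≤n+m _ _)

deg⇒two-indices : ∀ {x} ls → 2 ≤ deg x (edges ls) →
  ∃[ i ] ∃[ j ] (i ≢ j × x ∈ args (lookup ls i) × x ∈ args (lookup ls j))
deg⇒two-indices {x} (l ∷ ls) 2≤ = by-cases (x ∈? args l)
  where
  by-cases : Dec (x ∈ args l) → _
  by-cases (yes p) with ∈ᵥ-index ls (deg⇒∈ (edges ls) (deg-tail (args l) (edges ls) 2≤))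
  ... | j , q = Fin.zero , Fin.suc j , (λ ()) , p , q
  by-cases (no ¬p) with deg⇒two-indices ls (≤-trans 2≤ (≤-reflexive (deg-skip (edges ls) ¬p)))
  ... | i , j , i≢j , p , q = Fin.suc i , Fin.suc j , i≢j ∘ Fin.suc-injective , p , q

TwoOcc⇒Two : ∀ C → TwoOcc C → Two (edges (lits C))
TwoOcc⇒Two C twoOcc x∈ with twoOcc _ (∈ᵥ⇒∈-literal (lits C) x∈)
... | i , j , i≢j , p , q = two-indices⇒deg (lits C) i j i≢j p q

Two⇒TwoOcc : ∀ C → Two (edges (lits C)) → TwoOcc C
Two⇒TwoOcc C two x (l , l∈ , x∈) = deg⇒two-indices (lits C) (two (∈-literal⇒∈ᵥ l∈ x∈))

Unique-++⁻ʳ : ∀ {A : Set} (xs : List A) {ys} → Unique (xs ++ ys) → Unique ys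
Unique-++⁻ʳ []       u       = u
Unique-++⁻ʳ (x ∷ xs) (_ ∷ u) = Unique-++⁻ʳ xs u

Good⇒Syn2c : ∀ C → Good (lits C) → Syn2c C
Good⇒Syn2c C good = (arity≥1 , Unique-++⁻ʳ (headList (head C)) (Unique.map⁻ keys!)) ,
  Conn⇒Connected C arity≥1 conn , Two⇒TwoOcc C two
  where open Good good

-- Rigid clauses with distinct predicates are most general

unique-injective : ∀ {A B : Set} (k : A → B) {xs x y} → Unique (map k xs) → x ∈ xs → y ∈ xs → k x ≡ k y → x ≡ y
unique-injective k (_ ∷ _)  (here refl) (here refl) _  = refl
unique-injective k (k∉ ∷ _) (here refl) (there y∈)  eq = contradiction eq (All.lookup k∉ (∈-map⁺ k y∈))
unique-injective k (k∉ ∷ _) (there x∈)  (here refl) eq = contradiction (sym eq) (All.lookup k∉ (∈-map⁺ k x∈))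
unique-injective k (_ ∷ u)  (there x∈)  (there y∈)  eq = unique-injective k u x∈ y∈ eq

left-inverse : ∀ {A B : Set} → DecidableEquality B → A → (k : A → B) (xs : List A) →
  (∀ {x y} → x ∈ xs → y ∈ xs → k x ≡ k y → x ≡ y) → Σ (B → A) λ g → ∀ {x} → x ∈ xs → g (k x) ≡ x
left-inverse _≟B_ d k []       inj = (λ _ → d) , λ ()
left-inverse {A} {B} _≟B_ d k (x ∷ xs) inj with left-inverse _≟B_ d k xs (λ p q → inj (there p) (there q))
... | g , inv = g′ , inv′
  where
  g′ : B → A
  g′ b with b ≟B k x
  ... | yes _ = x
  ... | no _  = g b
  inv′ : ∀ {y} → y ∈ x ∷ xs → g′ (k y) ≡ y
  inv′ {y} y∈ with k y ≟B k x | y∈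
  ... | yes eq | _         = inj (here refl) y∈ (sym eq)
  ... | no _   | there y∈′ = inv y∈′
  ... | no ne  | here refl = contradiction refl ne

applyLit-headList : ∀ σ h bs →
  headList (applyHead σ h) ++ map (applyLit σ) bs ≡ map (applyLit σ) (headList h ++ bs)
applyLit-headList σ (just _) bs = refl
applyLit-headList σ nothing  bs = refl

edges-apply : ∀ σ ls → edges (map (applyLit σ) ls) ≡ map (map (tm σ)) (edges ls)
edges-apply σ []       = refl
edges-apply σ (l ∷ ls) = cong (_ ∷_) (edges-apply σ ls)

edges-↭ : ∀ {ls ls′} → ls ↭ ls′ → edges ls ↭ edges ls′
edges-↭ = map⁺ args

_≟-key_ : DecidableEquality (ℕ × ℕ)
_≟-key_ = ≡-dec _≟_ _≟_

-- The substitution that makes `C` an instance of `D` is injective on variables by rigidity, and on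
-- literals because their images have distinct keys. A left inverse then makes `D` an instance of
-- `C`.
Good⇒MostGeneral : ∀ C → Good (lits C) → MostGeneral C
Good⇒MostGeneral C good D (_ , connectedD , twoOccD) (σ , σhead , σbody) with ↭-map-inv (applyLit σ) σbody
... | zs , body≡ , D↭zs = ρ , ρhead , ↭-trans (↭-reflexive ρbody) (↭-sym D↭zs)
  where
  open Good good
  ls = headList (head D) ++ zs

  lits≡ : lits C ≡ map (applyLit σ) ls
  lits≡ = trans (cong₂ (λ h bs → headList h ++ bs) (sym σhead) body≡) (applyLit-headList σ (head D) zs)

  D↭ls : edges (lits D) ↭ edges ls
  D↭ls = edges-↭ (++⁺ˡ (headList (head D)) D↭zs)

  tm-injective : ∀ {x y} → x ∈ concat (edges ls) → y ∈ concat (edges ls) → tm σ x ≡ tm σ y → x ≡ y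
  tm-injective x∈ y∈ = rigid (edges ls) (tm σ) (sym (trans (cong edges lits≡) (edges-apply σ ls)))
    (Two-↭ D↭ls (TwoOcc⇒Two D twoOccD)) (Conn-↭ D↭ls (Connected⇒Conn D connectedD))
    (∈-concat⁻ (edges ls) x∈) (∈-concat⁻ (edges ls) y∈)

  key-injective : ∀ {l l′} → l ∈ ls → l′ ∈ ls → key (applyLit σ l) ≡ key (applyLit σ l′) → l ≡ l′
  key-injective = unique-injective (key ∘ applyLit σ)
    (transport Unique (trans (cong (map key) lits≡) (sym (map-∘ ls))) keys!)

  inv-tm  = left-inverse _≟_ 0 (tm σ) (concat (edges ls)) tm-injective
  inv-key = left-inverse _≟-key_ (lit 0 []) (key ∘ applyLit σ) ls key-injective

  ρ : Subst
  -- A key of `C` determines the literal of `D` that it comes from, and with it the original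
  -- predicate.
  ρ = subst (proj₁ inv-tm) (λ n p → pred (proj₁ inv-key (n , p)))

  ρσ : ∀ {l} → l ∈ ls → applyLit ρ (applyLit σ l) ≡ l
  ρσ {l} l∈ = cong₂ lit (cong pred (proj₂ inv-key l∈))
    (trans (sym (map-∘ (args l)))
      (map-id-local (All.tabulate λ x∈ → proj₂ inv-tm (∈-concat⁺ (∈-literal⇒∈ᵥ l∈ x∈)))))

  ρhead : applyHead ρ (head C) ≡ head D
  ρhead = trans (cong (applyHead ρ) (sym σhead)) (inv-head (head D) λ l∈ → ρσ (∈-++⁺ˡ l∈))
    where
    inv-head : ∀ h → (∀ {l} → l ∈ headList h → applyLit ρ (applyLit σ l) ≡ l) → applyHead ρ (applyHead σ h) ≡ h
    inv-head (just h) inv = cong just (inv (here refl))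
    inv-head nothing  _   = refl

  ρbody : map (applyLit ρ) (body C) ≡ zs
  ρbody = trans (cong (map (applyLit ρ)) body≡) (trans (sym (map-∘ zs))
    (map-id-local (All.tabulate λ l∈ → ρσ (∈-++⁺ʳ (headList (head D)) l∈))))

Good⇒H2c∞ : ∀ C → Good (lits C) → H2c∞ 2 C
Good⇒H2c∞ C good = Good⇒Syn2c C good , Good.arity≤2 good , Good⇒MostGeneral C good

Unique-resp-↭ : ∀ {A : Set} {xs ys : List A} → xs ↭ ys → Unique xs → Unique ys
Unique-resp-↭ p = Setoid↭.Unique-resp-↭ (setoid _) (↭⇒↭ₛ p)

Good-↭ : ∀ {ls ls′} → ls ↭ ls′ → Good ls → Good ls′
Good-↭ p g = record
  { arity≥1 = All-resp-↭ p arity≥1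
  ; arity≤2 = All-resp-↭ p arity≤2
  ; keys!   = Unique-resp-↭ (map⁺ key p) keys!
  ; conn    = Conn-↭ (edges-↭ p) conn
  ; two     = Two-↭ (edges-↭ p) two
  ; rigid   = Rigid-↭ (edges-↭ p) rigid
  }
  where open Good g

Good-rename : ∀ ι π {ls} → (∀ x → tm π (tm ι x) ≡ x) → (∀ n p → pr π n (pr ι n p) ≡ p) →
  Good ls → Good (map (applyLit ι) ls)
Good-rename ι π {ls} invt invp g = record
  { arity≥1 = All.map⁺ (All.map (λ {l} → ≤-trans′ (≤-reflexive (sym (length-map (tm ι) (args l))))) arity≥1)
  ; arity≤2 = All.map⁺ (All.map (λ {l} → ≤-trans (≤-reflexive (length-map (tm ι) (args l)))) arity≤2)
  ; keys!   = transport Unique (trans (sym (map-∘ ls)) (trans (map-cong key-ι ls) (map-∘ ls)))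
                (Unique.map⁺ ιkey-injective keys!)
  ; conn    = transport Conn (sym (edges-apply ι ls)) (Conn-map (tm ι) conn)
  ; two     = transport Two (sym (edges-apply ι ls)) (Two-map (tm ι) two)
  ; rigid   = transport Rigid (sym (edges-apply ι ls)) (Rigid-map (tm ι) (tm π) invt rigid)
  }
  where
  open Good g
  ≤-trans′ : ∀ {a b c} → b ≤ c → a ≤ b → a ≤ c
  ≤-trans′ p q = ≤-trans q p
  ιkey : ℕ × ℕ → ℕ × ℕ
  ιkey (n , p) = n , pr ι n p
  key-ι : ∀ l → ιkey (key l) ≡ key (applyLit ι l)
  key-ι l = cong (_, pr ι (arity l) (pred l)) (sym (length-map (tm ι) (args l)))
  ιkey-injective : ∀ {a b} → ιkey a ≡ ιkey b → a ≡ b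
  ιkey-injective {n , p} {m , q} eq with cong proj₁ eq
  ... | refl = cong (n ,_) (trans (sym (invp n p)) (trans (cong (pr π n) (cong proj₂ eq)) (invp n q)))

-- Most general clauses are rigid and have distinct predicates

unique-⊆⇒length≤ : ∀ {A : Set} {xs ys : List A} → Unique xs → (∀ {x} → x ∈ xs → x ∈ ys) → length xs ≤ length ys
unique-⊆⇒length≤ {xs = []}     _        _ = z≤n
unique-⊆⇒length≤ {xs = x ∷ xs} (x∉ ∷ u) sub with ∈-∃++ (sub (here refl))
... | as , bs , refl = ≤-trans (s≤s (unique-⊆⇒length≤ u sub′)) (≤-reflexive (sym (↭-length (shift x as bs))))
  where
  sub′ : ∀ {y} → y ∈ xs → y ∈ as ++ bs
  sub′ y∈ with ∈-resp-↭ (shift x as bs) (sub (there y∈))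
  ... | here refl = contradiction refl (All.lookup x∉ y∈)
  ... | there y∈′ = y∈′

-- Pigeonhole: if `x` and `y` collide, the entries other than `x` already reach everything, yet
-- there is one fewer of them.
surjective⇒injective : ∀ (h : ℕ → ℕ) xs → (∀ {x} → x ∈ xs → ∃[ y ] (y ∈ xs × x ≡ h y)) →
  ∀ {x y} → x ∈ xs → y ∈ xs → h x ≡ h y → x ≡ y
surjective⇒injective h xs surj {x} {y} x∈ y∈ hx≡hy with x ≟ y
... | yes x≡y = x≡y
... | no x≢y  = contradiction (≤-trans (s≤s (≤-trans (unique-⊆⇒length≤ (deduplicate-! xs) sub)
                    (≤-reflexive (length-map h W))))
                  (filter-notAll (λ z → ¬? (z ≟ x)) U (lose (∈-deduplicate⁺ _≟_ x∈) λ x≢x → x≢x refl))) (n≮n _)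
  where
  U = deduplicate _≟_ xs
  W = filter (λ z → ¬? (z ≟ x)) U
  sub : ∀ {u} → u ∈ U → u ∈ map h W
  sub u∈ with surj (∈-deduplicate⁻ _≟_ xs u∈)
  ... | z , z∈ , refl with z ≟ x
  ...   | yes refl = transport (_∈ map h W) (sym hx≡hy)
                       (∈-map⁺ h (∈-filter⁺ _ (∈-deduplicate⁺ _≟_ y∈) (x≢y ∘ sym)))
  ...   | no z≢x   = ∈-map⁺ h (∈-filter⁺ _ (∈-deduplicate⁺ _≟_ z∈) z≢x)

clause-preimage : ∀ σ ls h bs → map (applyLit σ) ls ≡ headList h ++ bs →
  ∃[ D ] (lits D ≡ ls × applyHead σ (head D) ≡ h × map (applyLit σ) (body D) ≡ bs)
clause-preimage σ ls       nothing  bs eq = clause nothing ls , refl , refl , eq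
clause-preimage σ (l ∷ ls) (just h) bs eq =
  clause (just l) ls , refl , cong just (proj₁ (∷-injective eq)) , proj₂ (∷-injective eq)

-- Both consequences of being most general come from this: the preimage `ls` forms a clause of which
-- `C` is an instance, so `C` can be mapped back onto it.
general : ∀ {C} → Syn2c C → MostGeneral C → ∀ σ ls → map (applyLit σ) ls ≡ lits C →
  Two (edges ls) → Conn (edges ls) → ∃[ ρ ] (map (applyLit ρ) (lits C) ↭ ls)
general {C} ((arity≥1 , body!) , _) mg σ ls eq two conn with clause-preimage σ ls (head C) (body C) eq
... | D , refl , σhead , σbody = instance-↭ (mg D ((arity≥1′ , body!′) , Conn⇒Connected D arity≥1′ conn , Two⇒TwoOcc D two)
                                             (σ , σhead , ↭-reflexive σbody))
  where
  arity≥1′ : All (λ l → 1 ≤ arity l) (lits D)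
  arity≥1′ = All.map (λ {l} 1≤ → ≤-trans 1≤ (≤-reflexive (length-map (tm σ) (args l))))
               (All.map⁻ (transport (All _) (sym eq) arity≥1))
  body!′ : Unique (body D)
  body!′ = Unique.map⁻ (transport Unique (sym σbody) body!)
  instance-↭ : InstanceOf D C → ∃[ ρ ] (map (applyLit ρ) (lits C) ↭ lits D)
  instance-↭ (ρ , ρhead , ρbody) = ρ , ↭-trans (↭-reflexive (sym (applyLit-headList ρ (head C) (body C))))
    (↭-trans (↭-reflexive (cong (λ h → headList h ++ map (applyLit ρ) (body C)) ρhead)) (++⁺ˡ (headList (head D)) ρbody))

relabel : (ℕ → ℕ) → Subst
relabel f = subst f (λ _ p → p)

lift-edges : ∀ f G ls → map (map f) G ≡ edges ls → ∃[ ls′ ] (map (applyLit (relabel f)) ls′ ≡ ls × edges ls′ ≡ G)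
lift-edges f []      []       eq = [] , refl , refl
lift-edges f (e ∷ G) (l ∷ ls) eq with lift-edges f G ls (proj₂ (∷-injective eq))
... | ls′ , p , q = lit (pred l) e ∷ ls′ , cong₂ _∷_ (cong (lit (pred l)) (proj₁ (∷-injective eq))) p , cong (e ∷_) q

-- `f` followed by the map back sends `G` onto a rearrangement of itself, hence permutes its
-- finitely many variables; so `f` identifies no two of them.
MostGeneral⇒Rigid : ∀ {C} → Syn2c C → MostGeneral C → Rigid (edges (lits C))
MostGeneral⇒Rigid {C} syn mg G f eq two conn {x} {y} x∈ y∈ fx≡fy with lift-edges f G (lits C) eq
... | ls , eq′ , refl with general {C} syn mg (relabel f) ls eq′ two conn
...   | ρ , ρC↭ls = surjective⇒injective (tm ρ ∘ f) (concat G) surj (∈-concat⁺ x∈) (∈-concat⁺ y∈) (cong (tm ρ) fx≡fy)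
  where
  gf↭ : map (map (tm ρ ∘ f)) G ↭ G
  gf↭ = ↭-trans (↭-reflexive (trans (sym (map-map-∘ (tm ρ) f G)) (trans (cong (map (map (tm ρ))) eq)
          (sym (edges-apply ρ (lits C)))))) (edges-↭ ρC↭ls)
  surj : ∀ {x} → x ∈ concat G → ∃[ y ] (y ∈ concat G × x ≡ tm ρ (f y))
  surj x∈ with ∈ᵥ-map⁻ (tm ρ ∘ f) G (Any-resp-↭ (↭-sym gf↭) (∈-concat⁻ G x∈))
  ... | y , y∈ , eq″ = y , ∈-concat⁺ y∈ , eq″

-- The name of a literal is the number of literals after it, which makes the names distinct.
number : List Literal → List Literal
number []       = []
number (l ∷ ls) = lit (length ls) (args l) ∷ number ls

predAt : List Literal → ℕ → ℕ
predAt []       _ = 0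
predAt (l ∷ ls) k with k ≟ length ls
... | yes _ = pred l
... | no _  = predAt ls k

predAt-hit : ∀ l ls → predAt (l ∷ ls) (length ls) ≡ pred l
predAt-hit l ls with length ls ≟ length ls
... | yes _ = refl
... | no ne = contradiction refl ne

predAt-miss : ∀ l ls {k} → k < length ls → predAt (l ∷ ls) k ≡ predAt ls k
predAt-miss l ls {k} k< with k ≟ length ls
... | yes refl = contradiction k< (n≮n k)
... | no _     = refl

number-< : ∀ ls → All (λ l → pred l < length ls) (number ls)
number-< []       = []
number-< (l ∷ ls) = ≤-refl ∷ All.map m≤n⇒m≤1+n (number-< ls)

number-! : ∀ ls → Unique (map pred (number ls))
number-! []       = []
number-! (l ∷ ls) = All.map⁺ (All.map (λ { p< refl → n≮n _ p< }) (number-< ls)) ∷ number-! ls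

edges-number : ∀ ls → edges (number ls) ≡ edges ls
edges-number []       = refl
edges-number (l ∷ ls) = cong (args l ∷_) (edges-number ls)

unnumber : List Literal → Subst
unnumber ls = subst id (λ _ → predAt ls)

unnumber-number : ∀ ls → map (applyLit (unnumber ls)) (number ls) ≡ ls
unnumber-number []       = refl
unnumber-number (l ∷ ls) = cong₂ _∷_ (cong₂ lit (predAt-hit l ls) (map-id (args l)))
  (trans (map-cong-local (All.map (λ {l′} p< → cong (λ p → lit p (map id (args l′))) (predAt-miss l ls p<)) (number-< ls)))
    (unnumber-number ls))

-- The clause maps back onto its numbered copy, and no substitution gives different predicates to
-- two literals with the same key.
MostGeneral⇒keys! : ∀ {C} → Syn2c C → MostGeneral C → Unique (map key (lits C))
MostGeneral⇒keys! {C} syn@(_ , connected , twoOcc) mg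
  with general {C} syn mg (unnumber (lits C)) (number (lits C)) (unnumber-number (lits C))
         (transport Two (sym (edges-number (lits C))) (TwoOcc⇒Two C twoOcc))
         (transport Conn (sym (edges-number (lits C))) (Connected⇒Conn C connected))
... | ρ , p = Unique.map⁻ {f = λ (n , q) → pr ρ n q} (transport Unique (trans (sym (map-∘ (lits C))) (map-∘ (lits C)))
                (Unique-resp-↭ (↭-sym (map⁺ pred p)) (number-! (lits C))))

H2c∞⇒Good : ∀ C → H2c∞ 2 C → Good (lits C)
H2c∞⇒Good C (syn@((arity≥1 , _) , connected , twoOcc) , arity≤2 , mg) = record
  { arity≥1 = arity≥1
  ; arity≤2 = arity≤2
  ; keys!   = MostGeneral⇒keys! {C} syn mg
  ; conn    = Connected⇒Conn C connected
  ; two     = TwoOcc⇒Two C twoOcc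
  ; rigid   = MostGeneral⇒Rigid {C} syn mg
  }

-- Resolution followed by factoring

applyLit-∘ : ∀ σ κ l → applyLit σ (applyLit κ l) ≡ applyLit (σ ∘ˢ κ) l
applyLit-∘ σ κ l = cong₂ lit
  (cong (λ n → pr σ n (pr κ (arity l) (pred l))) (length-map (tm κ) (args l)))
  (sym (map-∘ (args l)))

map-applyLit-∘ : ∀ σ κ ls → map (applyLit σ) (map (applyLit κ) ls) ≡ map (applyLit (σ ∘ˢ κ)) ls
map-applyLit-∘ σ κ ls = trans (sym (map-∘ ls)) (map-cong (applyLit-∘ σ κ) ls)

applyLit-id : ∀ l → applyLit idˢ l ≡ l
applyLit-id l = cong (lit (pred l)) (map-id (args l))

map-applyLit-id : ∀ ls → map (applyLit idˢ) ls ≡ ls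
map-applyLit-id ls = trans (map-cong applyLit-id ls) (map-id ls)

applyHead-id : ∀ h → applyHead idˢ h ≡ h
applyHead-id (just l) = cong just (applyLit-id l)
applyHead-id nothing  = refl

map-≡-∈ : ∀ {A B : Set} {f g : A → B} {xs x} → map f xs ≡ map g xs → x ∈ xs → f x ≡ g x
map-≡-∈ {xs = _ ∷ _} eq (here refl) = proj₁ (∷-injective eq)
map-≡-∈ {xs = _ ∷ _} eq (there x∈)  = map-≡-∈ (proj₂ (∷-injective eq)) x∈

-- Names of the second premise that also occur in the first are tagged by adding N;
-- every unifier of the derivation just removes the tags of one literal.
module Tagging (N : ℕ) where

  tag : ∀ {P : ℕ → Set} → (∀ x → Dec (P x)) → ℕ → ℕ
  tag P? x with P? x
  ... | yes _ = x
  ... | no _  = N + x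

  untag : ℕ → ℕ
  untag y with y <? N
  ... | yes _ = y
  ... | no _  = y ∸ N

  untag-low : ∀ {x} → x < N → untag x ≡ x
  untag-low {x} x<N with x <? N
  ... | yes _  = refl
  ... | no x≮N = contradiction x<N x≮N

  untag-tag : ∀ {P : ℕ → Set} (P? : ∀ x → Dec (P x)) → (∀ {x} → P x → x < N) → ∀ x → untag (tag P? x) ≡ x
  untag-tag P? low x with P? x
  ... | yes px = untag-low (low px)
  ... | no _ with N + x <? N
  ...   | yes N+x<N = contradiction (≤-trans (s≤s (m≤m+n N x)) N+x<N) (n≮n N)
  ...   | no _      = m+n∸m≡n N x

  tag-cases : ∀ {P : ℕ → Set} (P? : ∀ x → Dec (P x)) x → (P x × tag P? x ≡ x) ⊎ (¬ P x × N ≤ tag P? x)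
  tag-cases P? x with P? x
  ... | yes px = inj₁ (px , refl)
  ... | no ¬px = inj₂ (¬px , m≤m+n N x)

  π : Subst
  π = subst untag (λ _ → untag)

  Low : Literal → Set
  Low l = All (_< N) (args l) × pred l < N

  untagLit : Literal → Subst
  untagLit l = subst tmσ prσ
    where
    tmσ : ℕ → ℕ
    tmσ x with x ∈? args l
    ... | yes _ = untag x
    ... | no _  = x
    prσ : ℕ → ℕ → ℕ
    prσ n p with (n , p) ≟-key key l
    ... | yes _ = untag p
    ... | no _  = p

  module _ (l : Literal) where

    private σ = untagLit l

    tm-low : ∀ {x} → x < N → tm σ x ≡ x
    tm-low {x} x<N with x ∈? args l
    ... | yes _ = untag-low x<N
    ... | no _  = refl

    pr-low : ∀ n {p} → p < N → pr σ n p ≡ p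
    pr-low n {p} p<N with (n , p) ≟-key key l
    ... | yes _ = untag-low p<N
    ... | no _  = refl

    tm-hit : ∀ {x} → x ∈ args l → tm σ x ≡ untag x
    tm-hit {x} x∈ with x ∈? args l
    ... | yes _ = refl
    ... | no ∉  = contradiction x∈ ∉

    pr-hit : pr σ (arity l) (pred l) ≡ untag (pred l)
    pr-hit with (arity l , pred l) ≟-key key l
    ... | yes _ = refl
    ... | no ne = contradiction refl ne

    tm-untag : ∀ {x u} → x < N → untag u ≡ x → untag (tm σ u) ≡ x
    tm-untag {x} {u} x<N eq with u ∈? args l
    ... | yes _ = trans (cong untag eq) (untag-low x<N)
    ... | no _  = eq

    pr-untag : ∀ n {p q} → p < N → untag q ≡ p → untag (pr σ n q) ≡ p
    pr-untag n {p} {q} p<N eq with (n , q) ≟-key key l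
    ... | yes _ = trans (cong untag eq) (untag-low p<N)
    ... | no _  = eq

    applyLit-low : ∀ {M} → Low M → applyLit σ M ≡ M
    applyLit-low {M} (as< , p<) = cong₂ lit (pr-low (arity M) p<) (map-id-local (All.map tm-low as<))

    applyLit-hit : applyLit σ l ≡ applyLit π l
    applyLit-hit = cong₂ lit pr-hit (map-cong-local (All.tabulate tm-hit))

    -- Any unifier `τ` already agrees on each name of `l` and its untagged form, so it factors
    -- through `σ` as `τ` after `σ`.
    untagLit-MGU : ∀ {M} → Low M → applyLit π l ≡ M → MGU σ M l
    untagLit-MGU low refl = trans (applyLit-low low) (sym applyLit-hit) , λ τ u → τ , tm-factors τ u , pr-factors τ u
      where
      tm-factors : ∀ τ → Unifier τ (applyLit π l) l → ∀ x → tm τ x ≡ tm τ (tm σ x)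
      tm-factors τ u x with x ∈? args l
      ... | yes x∈ = sym (map-≡-∈ (trans (map-∘ (args l)) (cong args u)) x∈)
      ... | no _   = refl
      pr-factors : ∀ τ → Unifier τ (applyLit π l) l → ∀ n p → pr τ n p ≡ pr τ n (pr σ n p)
      pr-factors τ u n p with (n , p) ≟-key key l
      ... | yes refl = sym (trans (cong (λ m → pr τ m (untag p)) (sym (length-map untag (args l)))) (cong pred u))
      ... | no _     = refl

    map-low : ∀ {ls} → All Low ls → map (applyLit σ) ls ≡ ls
    map-low lows = map-id-local (All.map applyLit-low lows)

    head-low : ∀ h → All Low (headList h) → applyHead σ h ≡ h
    head-low (just h) (low ∷ _) = cong just (applyLit-low low)
    head-low nothing  _         = refl

-- The first premise has body `L ∷ B`, the second has head `L` and body `T ++ P`, and the conclusion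
-- has body `B ++ P`; `T` consists of the common literals, to be factored. By `linked`, unifying the
-- copies of `L` and `T` restores every variable that `P` shares with the first premise; by `apart`,
-- the predicates of `P` can keep their names.
module Derivation (h : Maybe Literal) (L : Literal) (B T P : List Literal)
  (T⊆B    : ∀ {M} → M ∈ T → M ∈ B)
  (linked : ∀ {x} → x ∈ᵥ edges P → x ∈ᵥ edges (L ∷ headList h ++ B) → x ∈ᵥ edges (L ∷ T))
  (apart  : ∀ {M} → M ∈ P → key M ∉ map key (L ∷ headList h ++ B))
  where

  private
    H₁ everything : List Literal
    H₁ = L ∷ headList h ++ B
    everything = H₁ ++ P
    N : ℕ
    N = bound (concat (edges everything) ++ map pred everything)

  open Tagging N

  private
    low : ∀ {l} → l ∈ everything → Low l
    low l∈ = All.tabulate (λ x∈ → <-bound (∈-++⁺ˡ (∈-concat⁺ (∈-literal⇒∈ᵥ l∈ x∈))))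
           , <-bound (∈-++⁺ʳ (concat (edges everything)) (∈-map⁺ pred l∈))

    low-L : Low L
    low-L = low (here refl)
    low-h : All Low (headList h)
    low-h = All.tabulate λ l∈ → low (there (∈-++⁺ˡ (∈-++⁺ˡ l∈)))
    low-B : All Low B
    low-B = All.tabulate λ l∈ → low (there (∈-++⁺ˡ (∈-++⁺ʳ (headList h) l∈)))
    low-P : All Low P
    low-P = All.tabulate λ l∈ → low (∈-++⁺ʳ H₁ l∈)

    -- Names from `N` on are tagged as well, so that `untag` inverts the renaming on all numbers and
    -- not only on those that occur.
    PrivTm : ℕ → Set
    PrivTm x = x < N × x ∉ᵥ edges H₁
    privTm? : ∀ x → Dec (PrivTm x)
    privTm? x = (x <? N) ×-dec ¬? (x ∈ᵥ? edges H₁)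
    PrivPr : ℕ → ℕ → Set
    PrivPr n p = p < N × (n , p) ∉ map key H₁
    privPr? : ∀ n p → Dec (PrivPr n p)
    privPr? n p = (p <? N) ×-dec ¬? ((n , p) ∈ₖ? map key H₁)

    ι : Subst
    ι = subst (tag privTm?) (λ n → tag (privPr? n))

  C₁ C₂ : Clause
  C₁ = clause h (L ∷ B)
  C₂ = applyClause ι (clause (just L) (T ++ P))

  Good-C₂ : Good (L ∷ T ++ P) → Good (lits C₂)
  Good-C₂ = Good-rename ι π (untag-tag privTm? proj₁) (λ n → untag-tag (privPr? n) proj₁)

  private
    -- `κ` is the substitution accumulated so far: each name it yields is the original up to a tag.
    record Inv (κ : Subst) : Set where
      field
        tm-inv : ∀ {x} → x < N → untag (tm κ x) ≡ x
        pr-inv : ∀ n {p} → p < N → untag (pr κ n p) ≡ p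
    open Inv

    inv-lit : ∀ {κ M} → Inv κ → Low M → applyLit π (applyLit κ M) ≡ M
    inv-lit {κ} {M} inv (as< , p<) = cong₂ lit (pr-inv inv (arity M) p<)
      (trans (sym (map-∘ (args M))) (map-id-local (All.map (tm-inv inv) as<)))

    inv-∘ : ∀ l {κ} → Inv κ → Inv (untagLit l ∘ˢ κ)
    inv-∘ l inv = record
      { tm-inv = λ x< → tm-untag l x< (tm-inv inv x<)
      ; pr-inv = λ n p< → pr-untag l n p< (pr-inv inv n p<)
      }

    inv-ι : Inv ι
    inv-ι = record { tm-inv = λ {x} _ → untag-tag privTm? proj₁ x ; pr-inv = λ n {p} _ → untag-tag (privPr? n) proj₁ p }

    -- A name that has been restored stays restored under all later unifiers.
    record Later (κ κ′ : Subst) : Set where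
      field
        inv    : Inv κ′
        tm-fix : ∀ {x} → x < N → tm κ x ≡ x → tm κ′ x ≡ x
        pr-fix : ∀ n {p} → p < N → pr κ n p ≡ p → pr κ′ n p ≡ p
    open Later

    later-refl : ∀ {κ} → Inv κ → Later κ κ
    later-refl i = record { inv = i ; tm-fix = λ _ eq → eq ; pr-fix = λ _ _ eq → eq }

    later-step : ∀ l {κ} → Inv κ → Later κ (untagLit l ∘ˢ κ)
    later-step l i = record
      { inv    = inv-∘ l i
      ; tm-fix = λ x< eq → trans (cong (tm (untagLit l)) eq) (tm-low l x<)
      ; pr-fix = λ n p< eq → trans (cong (pr (untagLit l) n) eq) (pr-low l n p<)
      }

    later-trans : ∀ {κ κ′ κ″} → Later κ κ′ → Later κ′ κ″ → Later κ κ″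
    later-trans a b = record
      { inv    = inv b
      ; tm-fix = λ x< eq → tm-fix b x< (tm-fix a x< eq)
      ; pr-fix = λ n p< eq → pr-fix b n p< (pr-fix a n p< eq)
      }

    untagged : ∀ {κ M x} → Inv κ → Low M → x ∈ args M → tm (untagLit (applyLit κ M) ∘ˢ κ) x ≡ x
    untagged {κ} {M} i (as< , _) x∈ = trans (tm-hit (applyLit κ M) (∈-map⁺ (tm κ) x∈)) (tm-inv i (All.lookup as< x∈))

    -- `S` lists the common literals whose copies are still to be factored away.
    state : Subst → List Literal → Clause
    state κ S = clause h (B ++ map (applyLit κ) S ++ map (applyLit κ) P)

    apply-state : ∀ l κ S → applyClause (untagLit l) (state κ S) ≡ state (untagLit l ∘ˢ κ) S
    apply-state l κ S = cong₂ clause (head-low l h low-h) (begin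
      map (applyLit σ) (B ++ map (applyLit κ) S ++ map (applyLit κ) P)
        ≡⟨ map-++ (applyLit σ) B _ ⟩
      map (applyLit σ) B ++ map (applyLit σ) (map (applyLit κ) S ++ map (applyLit κ) P)
        ≡⟨ cong₂ _++_ (map-low l low-B) (map-++ (applyLit σ) (map (applyLit κ) S) _) ⟩
      B ++ map (applyLit σ) (map (applyLit κ) S) ++ map (applyLit σ) (map (applyLit κ) P)
        ≡⟨ cong (B ++_) (cong₂ _++_ (map-applyLit-∘ σ κ S) (map-applyLit-∘ σ κ P)) ⟩
      B ++ map (applyLit (σ ∘ˢ κ)) S ++ map (applyLit (σ ∘ˢ κ)) P ∎)
      where
      open ≡-Reasoning
      σ = untagLit l

    factor-one : ∀ {κ M S} → Inv κ → M ∈ B → Factor (state κ (M ∷ S)) (state (untagLit (applyLit κ M) ∘ˢ κ) S)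
    factor-one {κ} {M} {S} i M∈ with ∈-∃++ M∈
    ... | pre , mid , B≡ = transport (Factor (state κ (M ∷ S)))
          (trans (cong (λ bs → applyClause σ (clause h bs)) body′) (apply-state (applyLit κ M) κ S))
          (factor pre M mid (applyLit κ M) rest σ body≡ (untagLit-MGU (applyLit κ M) lowM (inv-lit i lowM)))
      where
      σ = untagLit (applyLit κ M)
      lowM = All.lookup low-B M∈
      rest = map (applyLit κ) S ++ map (applyLit κ) P
      body≡ : B ++ applyLit κ M ∷ rest ≡ pre ++ M ∷ mid ++ applyLit κ M ∷ rest
      body≡ = trans (cong (_++ applyLit κ M ∷ rest) B≡) (++-assoc pre (M ∷ mid) _)
      body′ : pre ++ M ∷ mid ++ rest ≡ B ++ rest
      body′ = trans (sym (++-assoc pre (M ∷ mid) rest)) (cong (_++ rest) (sym B≡))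

    factor-all : ∀ S {κ} → Inv κ → (∀ {M} → M ∈ S → M ∈ B) →
      ∃[ κ′ ] (Later κ κ′ × (∀ {x} → x ∈ᵥ edges S → tm κ′ x ≡ x) × Factor* (state κ S) (state κ′ []))
    factor-all []      {κ} i _ = κ , later-refl i , (λ ()) , done
    factor-all (M ∷ S) {κ} i S⊆B with factor-all S (inv-∘ (applyLit κ M) i) (S⊆B ∘ there)
    ... | κ′ , later , fixed , steps = κ′ , later-trans (later-step (applyLit κ M) i) later , fixed′ ,
          step (factor-one i (S⊆B (here refl))) steps
      where
      lowM = All.lookup low-B (S⊆B (here refl))
      fixed′ : ∀ {x} → x ∈ᵥ edges (M ∷ S) → tm κ′ x ≡ x
      fixed′ (here x∈)  = tm-fix later (All.lookup (proj₁ lowM) x∈) (untagged i lowM x∈)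
      fixed′ (there x∈) = fixed x∈

    κ₀ : Subst
    κ₀ = untagLit (applyLit ι L) ∘ˢ ι

    resolvent : Resolvent C₁ C₂ (state κ₀ T)
    resolvent = transport (Resolvent C₁ C₂)
      (trans (cong (λ bs → applyClause (untagLit (applyLit ι L)) (clause h (B ++ bs))) (map-++ (applyLit ι) T P))
        (apply-state (applyLit ι L) ι T))
      (resolve [] L B (applyLit ι L) (untagLit (applyLit ι L)) refl refl
        (untagLit-MGU (applyLit ι L) low-L (inv-lit inv-ι low-L)))

    C₁∈H₁ : ∀ {l} → l ∈ lits C₁ → l ∈ H₁
    C₁∈H₁ = ∈-resp-↭ (shift L (headList h) B)

    apart-C : Apart C₁ C₂
    apart-C = tmApart , prApart
      where
      tmApart : ∀ x → TmOcc x C₁ → TmOcc x C₂ → ⊥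
      tmApart x (l , l∈ , x∈) (l′ , l′∈ , x∈′) with ∈-map⁻ (applyLit ι) {xs = L ∷ T ++ P} l′∈
      ... | l″ , _ , refl with ∈-map⁻ (tm ι) x∈′
      ...   | y , _ , refl with tag-cases privTm? y
      ...     | inj₁ ((_ , y∉) , eq) = y∉ (transport (_∈ᵥ edges H₁) eq (∈-literal⇒∈ᵥ (C₁∈H₁ l∈) x∈))
      ...     | inj₂ (_ , N≤)        = n≮n N (≤-trans (s≤s N≤) (All.lookup (proj₁ (low (∈-++⁺ˡ (C₁∈H₁ l∈)))) x∈))
      prApart : ∀ n p → PrOcc n p C₁ → PrOcc n p C₂ → ⊥
      prApart n p (l , l∈ , pred≡ , refl) (l′ , l′∈ , pred≡′ , ar≡) with ∈-map⁻ (applyLit ι) {xs = L ∷ T ++ P} l′∈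
      ... | l″ , _ , refl with tag-cases (privPr? (arity l″)) (pred l″)
      ...   | inj₁ ((_ , k∉) , eq) = k∉ (transport (_∈ map key H₁)
                (cong₂ _,_ (trans (sym ar≡) (length-map (tm ι) (args l″))) (trans pred≡ (trans (sym pred≡′) eq)))
                (∈-map⁺ key (C₁∈H₁ l∈)))
      ...   | inj₂ (_ , N≤) = n≮n N (≤-trans (s≤s (≤-trans N≤ (≤-reflexive (trans pred≡′ (sym pred≡)))))
                (proj₂ (low (∈-++⁺ˡ (C₁∈H₁ l∈)))))

    -- A variable of `P` either was never tagged or, by `linked`, occurs in `L` or `T` and was
    -- restored when their copies were unified.
    P-fixed : ∀ {κ} → Later κ₀ κ → (∀ {x} → x ∈ᵥ edges T → tm κ x ≡ x) → map (applyLit κ) P ≡ P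
    P-fixed {κ} later fixedT = map-id-local (All.tabulate λ M∈ → cong₂ lit (prFixed M∈)
      (map-id-local (All.tabulate λ x∈ → tmFixed (∈-literal⇒∈ᵥ M∈ x∈) (All.lookup (proj₁ (All.lookup low-P M∈)) x∈))))
      where
      later-ι = later-trans (later-step (applyLit ι L) inv-ι) later
      linked-fixed : ∀ {x} → x < N → x ∈ᵥ edges (L ∷ T) → tm κ x ≡ x
      linked-fixed x< (here x∈)  = tm-fix later x< (untagged inv-ι low-L x∈)
      linked-fixed x< (there x∈) = fixedT x∈
      tmFixed : ∀ {x} → x ∈ᵥ edges P → x < N → tm κ x ≡ x
      tmFixed {x} x∈ x< with tag-cases privTm? x
      ... | inj₁ (_ , eq)  = tm-fix later-ι x< eq
      ... | inj₂ (¬pv , _) = linked-fixed x< (linked x∈ (decidable-stable (x ∈ᵥ? edges H₁) λ ∉ → ¬pv (x< , ∉)))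
      prFixed : ∀ {M} → M ∈ P → pr κ (arity M) (pred M) ≡ pred M
      prFixed {M} M∈ with tag-cases (privPr? (arity M)) (pred M)
      ... | inj₁ (_ , eq)  = pr-fix later-ι (arity M) (proj₂ (All.lookup low-P M∈)) eq
      ... | inj₂ (¬pv , _) = contradiction (proj₂ (All.lookup low-P M∈) , apart M∈) ¬pv

    derived : Clause
    derived = clause h (B ++ P)

    derived≈ : ∀ {C} → head C ≡ h → body C ↭ P ++ B → derived ≈ᶜ C
    derived≈ head≡ body↭ = idˢ , (idˢ , ((λ _ → refl) , λ _ _ → refl) , ((λ _ → refl) , λ _ _ → refl)) ,
      trans (applyHead-id h) (sym head≡) ,
      (λ l∈ → ∈-resp-↭ (↭-trans (++-comm B P) (↭-sym body↭)) (transport (_ ∈_) (map-applyLit-id (B ++ P)) l∈)) ,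
      (λ l∈ → transport (_ ∈_) (sym (map-applyLit-id (B ++ P))) (∈-resp-↭ (↭-trans body↭ (++-comm P B)) l∈))

    derivation : ∃[ κ ] (Later κ₀ κ × (∀ {x} → x ∈ᵥ edges T → tm κ x ≡ x) × Factor* (state κ₀ T) (state κ [])) →
      Factor* (state κ₀ T) derived
    derivation (κ , later , fixedT , steps) =
      transport (λ Q → Factor* (state κ₀ T) (clause h (B ++ Q))) (P-fixed later fixedT) steps

  conclusion : ∀ {C} → head C ≡ h → body C ↭ P ++ B → ConclusionOf C₁ C₂ C
  conclusion head≡ body↭ = apart-C , state κ₀ T , derived , resolvent ,
    derivation (factor-all T (inv-∘ (applyLit ι L) inv-ι) T⊆B) , derived≈ head≡ body↭

open Good

-- Separations

extract : ∀ {A : Set} {x : A} {xs} → x ∈ xs → ∃[ ys ] (xs ↭ x ∷ ys)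
extract x∈ with ∈-∃++ x∈
... | as , bs , refl = as ++ bs , shift _ as bs

pick : ∀ {x} ls → x ∈ᵥ edges ls → ∃[ l ] ∃[ ls′ ] (ls ↭ l ∷ ls′ × x ∈ args l)
pick ls x∈ with ∈ᵥ⇒∈-literal ls x∈
... | l , l∈ , x∈l with extract l∈
...   | ls′ , p = l , ls′ , p , x∈l

edges-++-∈ : ∀ {x} X {Y} → x ∈ᵥ edges (X ++ Y) → x ∈ᵥ edges X ⊎ x ∈ᵥ edges Y
edges-++-∈ X {Y} x∈ = ∈ᵥ-++⁻ (edges X) (transport (_ ∈ᵥ_) (map-++ args X Y) x∈)

∈ᵥ-edgesˡ : ∀ {x} X {Y} → x ∈ᵥ edges X → x ∈ᵥ edges (X ++ Y)
∈ᵥ-edgesˡ X {Y} x∈ = transport (_ ∈ᵥ_) (sym (map-++ args X Y)) (Any.++⁺ˡ x∈)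

∈ᵥ-edgesʳ : ∀ {x} X {Y} → x ∈ᵥ edges Y → x ∈ᵥ edges (X ++ Y)
∈ᵥ-edgesʳ X {Y} x∈ = transport (_ ∈ᵥ_) (sym (map-++ args X Y)) (Any.++⁺ʳ (edges X) x∈)

deg-edges-++ : ∀ x X {Y} → deg x (edges (X ++ Y)) ≡ deg x (edges X) + deg x (edges Y)
deg-edges-++ x X {Y} = trans (cong (deg x) (map-++ args X Y)) (weight-++ (ind x) (edges X))

Unique-++⁻ˡ : ∀ {A : Set} (xs : List A) {ys} → Unique (xs ++ ys) → Unique xs
Unique-++⁻ˡ []       _       = []
Unique-++⁻ˡ (x ∷ xs) (x∉ ∷ u) = All.++⁻ˡ xs x∉ ∷ Unique-++⁻ˡ xs u

Unique-++-disjoint : ∀ {A : Set} (xs : List A) {ys x} → Unique (xs ++ ys) → x ∈ xs → x ∉ ys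
Unique-++-disjoint (x ∷ xs) (x∉ ∷ u) (here refl) y∈ = All.lookup (All.++⁻ʳ xs x∉) y∈ refl
Unique-++-disjoint (x ∷ xs) (x∉ ∷ u) (there x∈)  y∈ = Unique-++-disjoint xs u x∈ y∈

split-colour : ∀ c β ls → Mono c (edges ls) → ∃[ X ] ∃[ Y ] (ls ↭ X ++ Y ×
  (∀ {z} → z ∈ᵥ edges X → c z ≡ β) × (∀ {z} → z ∈ᵥ edges Y → c z ≢ β))
split-colour c β []       _        = [] , [] , refl , (λ ()) , λ ()
split-colour c β (lit p [] ∷ ls) (_ ∷ m) with split-colour c β ls m
... | X , Y , perm , onX , onY = lit p [] ∷ X , Y , prep _ perm , (λ { (there z∈) → onX z∈ }) , onY
split-colour c β (l@(lit p (x ∷ xs)) ∷ ls) (ml ∷ m) with split-colour c β ls m | c x Bool.≟ β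
... | X , Y , perm , onX , onY | yes eq = l ∷ X , Y , prep l perm ,
      (λ { (here z∈) → trans (ml _ x z∈ (here refl)) eq ; (there z∈) → onX z∈ }) , onY
... | X , Y , perm , onX , onY | no ne = X , l ∷ Y , ↭-trans (prep l perm) (↭-sym (shift l X Y)) , onX ,
      λ { (here z∈) eq → ne (trans (ml x _ (here refl) z∈) eq) ; (there z∈) → onY z∈ }

-- For a unary literal or a loop the other end is `x` itself, so unary literals need no separate
-- treatment as edges.
other-end : ∀ {x : ℕ} {e} → x ∈ e → length e ≤ 2 → ∃[ y ] (y ∈ e × (∀ {z} → z ∈ e → z ≡ x ⊎ z ≡ y))
other-end {e = x ∷ []}     (here refl)         _ = x , here refl , λ { (here eq) → inj₁ eq }
other-end {e = x ∷ y ∷ []} (here refl)         _ =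
  y , there (here refl) , λ { (here eq) → inj₁ eq ; (there (here eq)) → inj₂ eq }
other-end {e = y ∷ x ∷ []} (there (here refl)) _ = y , here refl , λ { (here eq) → inj₂ eq ; (there (here eq)) → inj₁ eq }
other-end {e = _ ∷ _ ∷ _ ∷ _} _ (s≤s (s≤s ()))

deg-drop : ∀ {x e f n} G → ¬ (x ∈ e × x ∈ f) → suc n ≤ deg x (e ∷ f ∷ G) → n ≤ deg x G
deg-drop {x} {e} {f} G ¬both n< with x ∈? f
... | yes x∈f = s≤s⁻¹ (≤-trans n< (≤-reflexive (cong₂ _+_ (ind-∉ {x} {e} λ x∈e → ¬both (x∈e , x∈f)) refl)))
... | no x∉f  = deg-tail e G n<

all-or : ∀ {A : Set} {P : ℕ → Set} xs → (∀ {x} → x ∈ xs → A ⊎ P x) → A ⊎ (∀ {x} → x ∈ xs → P x)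
all-or []       _ = inj₂ λ ()
all-or (x ∷ xs) f with f (here refl) | all-or xs (f ∘ there)
... | inj₁ a | _      = inj₁ a
... | inj₂ _ | inj₁ a = inj₁ a
... | inj₂ p | inj₂ q = inj₂ λ { (here refl) → p ; (there x∈) → q x∈ }

-- With no shared variable, membership in `G` would be a colouring that is constant on every literal
-- but takes both values.
shared-nonempty : ∀ {vs G H x y} → Conn (G ++ H) → Shared vs G H → x ∈ᵥ G → y ∈ᵥ H → ∃[ v ] v ∈ vs
shared-nonempty {v ∷ _} _ _ _ _ = v , here refl
shared-nonempty {[]} {G} {H} {x} {y} conn sh x∈ y∈ =
  case trans (sym (dec-true (x ∈ᵥ? G) x∈))
    (trans (conn c (All.++⁺ monoG monoH) (Any.++⁺ˡ x∈) (Any.++⁺ʳ G y∈)) (onH y∈)) of λ ()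
  where
  c : ℕ → Bool
  c z = does (z ∈ᵥ? G)
  onG : ∀ {z} → z ∈ᵥ G → c z ≡ true
  onG z∈ = dec-true (_ ∈ᵥ? G) z∈
  onH : ∀ {z} → z ∈ᵥ H → c z ≡ false
  onH z∈ = dec-false (_ ∈ᵥ? G) λ z∈G → case complete sh z∈G z∈ of λ ()
  monoG : Mono c G
  monoG = All.tabulate λ e∈ a b a∈ b∈ → trans (onG (lose e∈ a∈)) (sym (onG (lose e∈ b∈)))
  monoH : Mono c H
  monoH = All.tabulate λ e∈ a b a∈ b∈ → trans (onH (lose e∈ a∈)) (sym (onH (lose e∈ b∈)))

-- In the cubic case the position of `a` in the new literal takes the place of one in a removed
-- literal, which preserves the bound behind rigidity.
occ-replace : ∀ {a l} x G → a ∈ l → occ x (l ∷ G) ≤ 3 → occ x ((a ∷ []) ∷ G) ≤ 3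
occ-replace {a} {l} x G a∈ ≤3 with x ≟ a
... | yes refl = ≤-trans (+-monoˡ-≤ (occ x G) (cnt-∈ a∈)) ≤3
... | no _     = ≤-trans (m≤n+m (occ x G) (cnt x l)) ≤3

occ-tail : ∀ x e G → occ x (e ∷ G) ≤ 3 → occ x G ≤ 3
occ-tail x e G = ≤-trans (m≤n+m (occ x G) (cnt x e))

nonempty : ∀ {A : Set} {xs : List A} → 1 ≤ length xs → ∃[ x ] x ∈ xs
nonempty {xs = x ∷ _} _ = x , here refl

-- From separations to inferences

Goal : Clause → Set
Goal C = ∃[ b′ ] (b′ < size C × ∃[ C₁ ] ∃[ C₂ ]
  (H2c 2 b′ C₁ × H2c 2 b′ C₂ × ConclusionOf C₁ C₂ C))

-- At a single cut variable rigidity is inherited by gluing; for two it follows from the bound on occ.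
Small : List ℕ → Graph → Set
Small zs G = length zs ≤ 1 ⊎ (length zs ≤ 2 × (∀ x → occ x G ≤ 3))

Small⇒≤2 : ∀ {zs G} → Small zs G → length zs ≤ 2
Small⇒≤2 (inj₁ ≤1)       = m≤n⇒m≤1+n ≤1
Small⇒≤2 (inj₂ (≤2 , _)) = ≤2

module Reduce (C : Clause) (good : Good (lits C)) where

  ls : List Literal
  ls = lits C

  G : Graph
  G = edges ls

  newPred : ℕ
  newPred = bound (map pred ls)

  new : List ℕ → Literal
  new = lit newPred

  good-part : ∀ {vs S R} → ls ↭ S ++ R → 1 ≤ length vs → length vs ≤ 2 →
    Conn (vs ∷ edges S) → Two (vs ∷ edges S) → Rigid (vs ∷ edges S) → Good (new vs ∷ S)
  good-part {vs} {S} {R} p 1≤ ≤2 conn two rigid = record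
    { arity≥1 = 1≤ ∷ All.++⁻ˡ S (All-resp-↭ p (arity≥1 good))
    ; arity≤2 = ≤2 ∷ All.++⁻ˡ S (All-resp-↭ p (arity≤2 good))
    ; keys!   = All.tabulate fresh ∷
        Unique-++⁻ˡ (map key S) (transport Unique (map-++ key S R) (Unique-resp-↭ (map⁺ key p) (keys! good)))
    ; conn    = conn
    ; two     = two
    ; rigid   = rigid
    }
    where
    fresh : ∀ {k} → k ∈ map key S → key (new vs) ≢ k
    fresh k∈ eq with ∈-map⁻ key k∈
    ... | l , l∈ , refl = n≮n newPred (transport (_< newPred) (sym (cong proj₂ eq))
                            (<-bound (∈-map⁺ pred (∈-resp-↭ (↭-sym p) (∈-++⁺ˡ l∈)))))

  h = head C

  -- The bound `b′` is one less than the size of `C`. The first premise trades the literals of `P`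
  -- for the single new one, so it is smaller as soon as `P` has two.
  combine : ∀ {vs B T P} → body C ↭ P ++ B → (∀ {M} → M ∈ T → M ∈ B) →
    (∀ {x} → x ∈ᵥ edges P → x ∈ᵥ edges (new vs ∷ headList h ++ B) → x ∈ᵥ edges (new vs ∷ T)) →
    Good (new vs ∷ headList h ++ B) → Good (new vs ∷ T ++ P) →
    2 ≤ length P → length (T ++ P) < size C → Goal C
  combine {vs} {B} {T} {P} p T⊆B linked good₁ good₂ 2≤P T++P< = by-size (size C) refl
    where
    P∉ : ∀ {M} → M ∈ P → key M ∉ map key (new vs ∷ headList h ++ B)
    P∉ {M} M∈ (here eq) with keys! good₂
    ... | k∉ ∷ _ = All.lookup k∉ (∈-map⁺ key (∈-++⁺ʳ T M∈)) (sym eq)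
    P∉ {M} M∈ (there k∈) = Unique-++-disjoint (map key P) (transport Unique (map-++ key P _)
      (Unique-resp-↭ (map⁺ key perm) (keys! good))) (∈-map⁺ key M∈) k∈
      where
      perm : ls ↭ P ++ headList h ++ B
      perm = ↭-trans (++⁺ˡ (headList h) p) (shifts (headList h) P)
    module D = Derivation h (new vs) B T P T⊆B linked P∉
    size₁ : suc (suc (length B)) ≤ size C
    size₁ = ≤-trans (+-monoˡ-≤ (length B) 2≤P) (≤-reflexive (sym (trans (↭-length p) (length-++ P))))
    by-size : ∀ n → size C ≡ n → Goal C
    by-size zero    eq = contradiction (≤-trans size₁ (≤-reflexive eq)) λ ()
    by-size (suc b) eq = b , ≤-reflexive (sym eq) , D.C₁ , D.C₂ ,
      (Good⇒H2c∞ D.C₁ (Good-↭ (↭-sym (shift (new vs) (headList h) B)) good₁) ,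
        s≤s⁻¹ (≤-trans size₁ (≤-reflexive eq))) ,
      (Good⇒H2c∞ D.C₂ (D.Good-C₂ good₂) ,
        s≤s⁻¹ (≤-trans (s≤s (≤-reflexive (length-map _ (T ++ P)))) (≤-trans T++P< (≤-reflexive eq)))) ,
      D.conclusion refl p

  element : ∀ {l S R} → ls ↭ S ++ R → l ∈ S → ∃[ x ] x ∈ᵥ edges S
  element p l∈ with nonempty (All.lookup (arity≥1 good) (∈-resp-↭ (↭-sym p) (∈-++⁺ˡ l∈)))
  ... | x , x∈ = x , ∈-literal⇒∈ᵥ l∈ x∈

  Separates : List ℕ → List Literal → List Literal → Set
  Separates zs X Y = ∀ {z} → z ∈ᵥ edges X → z ∈ᵥ edges Y → z ∈ zs

  -- Here the premises have no literal in common. The two lower bounds make both of them small: the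
  -- first has one literal in place of `A`, and the body of the second is `A` without `B`.
  separate : ∀ {A B zs} → body C ↭ A ++ B → Separates zs (headList h ++ B) A → Small zs G →
    2 ≤ length A → 1 ≤ length B → Goal C
  separate {A} {B} {zs} p sep small 2≤A 1≤B = combine p (λ ()) (λ { x∈A (here x∈) → here x∈
                                                     ; x∈A (there x∈X) → here (complete sh x∈X x∈A) })
      (good-part ls↭XA 1≤vs vs≤2 (Conn-side sh v∈ connXA) (Two-side sh twoXA) (rigid-side sh connXA twoXA rigidXA occXA))
      (good-part ls↭AX 1≤vs vs≤2 (Conn-side sh′ v∈ connAX) (Two-side sh′ twoAX) (rigid-side sh′ connAX twoAX rigidAX occAX))
      2≤A
      (≤-trans (≤-trans (≤-reflexive (+-comm 1 (length A))) (+-monoʳ-≤ (length A) 1≤B))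
        (≤-reflexive (sym (trans (↭-length p) (length-++ A)))))
    where
    X = headList h ++ B
    ls↭AX : ls ↭ A ++ X
    ls↭AX = ↭-trans (++⁺ˡ (headList h) p) (shifts (headList h) A)
    ls↭XA : ls ↭ X ++ A
    ls↭XA = ↭-trans ls↭AX (++-comm A X)
    G↭XA : G ↭ edges X ++ edges A
    G↭XA = ↭-trans (edges-↭ ls↭XA) (↭-reflexive (map-++ args X A))
    G↭AX : G ↭ edges A ++ edges X
    G↭AX = ↭-trans (edges-↭ ls↭AX) (↭-reflexive (map-++ args A X))
    connXA = Conn-↭ G↭XA (conn good)
    connAX = Conn-↭ G↭AX (conn good)
    twoXA : Two (edges X ++ edges A)
    twoXA = Two-↭ G↭XA (two good)
    twoAX : Two (edges A ++ edges X)
    twoAX = Two-↭ G↭AX (two good)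
    rigidXA = Rigid-↭ G↭XA (rigid good)
    rigidAX = Rigid-↭ G↭AX (rigid good)
    shared? : ∀ x → Dec (x ∈ᵥ edges X × x ∈ᵥ edges A)
    shared? x = (x ∈ᵥ? edges X) ×-dec (x ∈ᵥ? edges A)
    -- `zs` only bounds the shared variables from above; the new literal has to carry exactly these,
    -- each of them once.
    vs = filter shared? (deduplicate _≟_ zs)
    vs≤zs : length vs ≤ length zs
    vs≤zs = ≤-trans (length-filter shared? (deduplicate _≟_ zs))
      (unique-⊆⇒length≤ (deduplicate-! zs) (∈-deduplicate⁻ _≟_ zs))
    vs≤2 : length vs ≤ 2
    vs≤2 = ≤-trans vs≤zs (Small⇒≤2 {zs} {G} small)
    sh : Shared vs (edges X) (edges A)
    sh = record
      { left     = λ x∈ → proj₁ (proj₂ (∈-filter⁻ shared? {xs = deduplicate _≟_ zs} x∈))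
      ; right    = λ x∈ → proj₂ (proj₂ (∈-filter⁻ shared? {xs = deduplicate _≟_ zs} x∈))
      ; complete = λ x∈X x∈A → ∈-filter⁺ shared? (∈-deduplicate⁺ _≟_ (sep x∈X x∈A)) (x∈X , x∈A)
      }
    sh′ = Shared-sym sh
    vs! : Unique vs
    vs! = Unique.filter⁺ shared? (deduplicate-! zs)
    some-v : ∃[ v ] v ∈ vs
    some-v = shared-nonempty connXA sh
      (proj₂ (element ls↭XA (∈-++⁺ʳ (headList h) (proj₂ (nonempty 1≤B)))))
      (proj₂ (element ls↭AX (proj₂ (nonempty (≤-trans (s≤s z≤n) 2≤A)))))
    v∈ = proj₂ some-v
    1≤vs : 1 ≤ length vs
    1≤vs = ∈⇒1≤ v∈
      where
      ∈⇒1≤ : ∀ {v : ℕ} {vs} → v ∈ vs → 1 ≤ length vs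
      ∈⇒1≤ (here _)  = s≤s z≤n
      ∈⇒1≤ (there _) = s≤s z≤n
    occXA : (∀ x → occ x G ≤ 3) → ∀ x → occ x (edges X ++ edges A) ≤ 3
    occXA occ≤3 x = ≤-trans (≤-reflexive (sym (weight-↭ (cnt x) G↭XA))) (occ≤3 x)
    occAX : (∀ x → occ x G ≤ 3) → ∀ x → occ x (edges A ++ edges X) ≤ 3
    occAX occ≤3 x = ≤-trans (≤-reflexive (sym (weight-↭ (cnt x) G↭AX))) (occ≤3 x)
    rigid-side : ∀ {K H} → Shared vs K H → Conn (K ++ H) → Two (K ++ H) → Rigid (K ++ H) →
      ((∀ x → occ x G ≤ 3) → ∀ x → occ x (K ++ H) ≤ 3) → Rigid (vs ∷ K)
    rigid-side {K} {H} sh c t r o = go small vs vs≤zs sh vs! v∈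
      where
      go : Small zs G → ∀ vs → length vs ≤ length zs → Shared vs K H → Unique vs → ∀ {v} → v ∈ vs → Rigid (vs ∷ K)
      go (inj₂ (_ , occ≤3)) vs _ sh u _ = occ≤3⇒Rigid λ x → occ-side sh u x (o occ≤3 x)
      go (inj₁ ≤1) (v ∷ [])    _  sh _ _ = Rigid-side sh c t r
      go (inj₁ ≤1) (_ ∷ _ ∷ _) ≤zs _ _ _ = contradiction (≤-trans ≤zs ≤1) λ { (s≤s ()) }

  -- The part with the head becomes the first premise. The head may be one of its two literals,
  -- which still leaves the one body literal that `separate` asks for.
  partition-goal : ∀ {X Y zs} → ls ↭ X ++ Y → Separates zs X Y → Small zs G →
    2 ≤ length X → 2 ≤ length Y → Goal C
  partition-goal {X} {Y} {zs} p sep small 2≤X 2≤Y = by-head h refl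
    where
    Sep-sym : Separates zs Y X
    Sep-sym x∈Y x∈X = sep x∈X x∈Y
    with-head : ∀ {X Y l} → h ≡ just l → l ∈ X → ls ↭ X ++ Y → Separates zs X Y → 2 ≤ length X → 2 ≤ length Y → Goal C
    with-head {X} {Y} {l} eq l∈ p sep 2≤X 2≤Y with extract l∈
    ... | X′ , q = separate body↭
                     (λ z∈ → sep (Any-resp-↭ (edges-↭ (↭-sym q)) (transport (λ h → _ ∈ᵥ edges (headList h ++ X′)) eq z∈)))
                     small 2≤Y (s≤s⁻¹ (≤-trans 2≤X (≤-reflexive (↭-length q))))
      where
      body↭ : body C ↭ Y ++ X′
      body↭ = ↭-trans (drop-∷ (↭-trans (↭-reflexive (cong (λ h → headList h ++ body C) (sym eq))) (↭-trans p (++⁺ʳ Y q))))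
                (++-comm X′ Y)
    by-head : ∀ h′ → h ≡ h′ → Goal C
    by-head nothing eq = separate (↭-trans (↭-reflexive (cong (λ h → headList h ++ body C) (sym eq))) p)
      (λ z∈ → Sep-sym (transport (λ h → _ ∈ᵥ edges (headList h ++ Y)) eq z∈)) small 2≤X (≤-trans (s≤s z≤n) 2≤Y)
    by-head (just l) eq with ∈-++⁻ X (∈-resp-↭ p (transport (λ h → l ∈ headList h ++ body C) (sym eq) (here refl)))
    ... | inj₁ l∈X = with-head eq l∈X p sep 2≤X 2≤Y
    ... | inj₂ l∈Y = with-head eq l∈Y (↭-trans p (++-comm X Y)) Sep-sym 2≤Y 2≤X

-- Variables with at least four positions

cnt⇒∈ : ∀ {x e} → 1 ≤ cnt x e → x ∈ e
cnt⇒∈ {x} {e} 1≤ with x ∈? e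
... | yes x∈ = x∈
... | no x∉  = contradiction (≤-trans 1≤ (≤-reflexive (cnt-∉ x∉))) λ ()

module Heavy-variable (C : Clause) (good : Good (lits C)) where

  open Reduce C good

  loop-or-simple : ∀ v (ls : List Literal) → (∃[ l ] (l ∈ ls × 2 ≤ cnt v (args l))) ⊎ occ v (edges ls) ≤ deg v (edges ls)
  loop-or-simple v []       = inj₂ z≤n
  loop-or-simple v (l ∷ ls) with 2 ≤? cnt v (args l) | loop-or-simple v ls
  ... | yes 2≤ | _                    = inj₁ (l , here refl , 2≤)
  ... | no _   | inj₁ (l′ , l′∈ , 2≤) = inj₁ (l′ , there l′∈ , 2≤)
  ... | no ≱2  | inj₂ occ≤deg = inj₂ (+-mono-≤ cnt≤ind occ≤deg)
    where
    cnt≤ind : cnt v (args l) ≤ ind v (args l)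
    cnt≤ind with v ∈? args l
    ... | yes _ = s≤s⁻¹ (≰⇒> ≱2)
    ... | no v∉ = ≤-reflexive (cnt-∉ v∉)

  -- The literals of `R` on the side of the fresh variable join `e` and `f`; those at `v`, at least
  -- two, form the other part with the rest of `R`.
  from-cut : ∀ {v e f R} → ls ↭ e ∷ f ∷ R → Cut v (args e) (args f) (edges R) → Goal C
  from-cut {v} {e} {f} {R} p cut = by-colour (split-colour colour β R mono)
    where
    open Cut cut
    by-colour : ∃[ X ] ∃[ Y ] (R ↭ X ++ Y ×
      (∀ {z} → z ∈ᵥ edges X → colour z ≡ β) × (∀ {z} → z ∈ᵥ edges Y → colour z ≢ β)) → Goal C
    by-colour (X , Y , q , onX , onY) = partition-goal {e ∷ f ∷ X} {Y} {v ∷ []} (↭-trans p (prep e (prep f q))) sep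
      (inj₁ ≤-refl) (s≤s (s≤s z≤n)) 2≤Y
      where
      via : ∀ {z} → z ∈ args e ⊎ z ∈ args f → z ∈ᵥ edges Y → z ∈ v ∷ []
      via {z} z∈ z∈Y with z ≟ v
      ... | yes z≡v = here z≡v
      ... | no z≢v  = contradiction (branch z∈ z≢v) (onY z∈Y)
      sep : Separates (v ∷ []) (e ∷ f ∷ X) Y
      sep (here z∈)          z∈Y = via (inj₁ z∈) z∈Y
      sep (there (here z∈))  z∈Y = via (inj₂ z∈) z∈Y
      sep (there (there z∈)) z∈Y = contradiction (onX z∈) (onY z∈Y)
      2≤Y : 2 ≤ length Y
      2≤Y = begin
        2                                     ≤⟨ heavy ⟩
        deg v (edges R)                       ≡⟨ weight-↭ (ind v) (edges-↭ q) ⟩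
        deg v (edges (X ++ Y))                ≡⟨ deg-edges-++ v X ⟩
        deg v (edges X) + deg v (edges Y)     ≡⟨ cong (_+ deg v (edges Y)) (deg-∉ (v≢ ∘ onX)) ⟩
        deg v (edges Y)                       ≤⟨ deg≤length v (edges Y) ⟩
        length (edges Y)                      ≡⟨ length-map args Y ⟩
        length Y                              ∎ where open ≤-Reasoning

  cut-goal : ∀ {v e f R} → ls ↭ e ∷ f ∷ R → v ∈ args e → v ∈ args f → Heavy v (args e) (args f) (edges R) → Goal C
  cut-goal p v∈e v∈f hv = from-cut p
    (rigid⇒cut (Conn-↭ (edges-↭ p) (conn good)) (Two-↭ (edges-↭ p) (two good)) (Rigid-↭ (edges-↭ p) (rigid good)) v∈e v∈f hv)

  loop-goal : ∀ {v l} → l ∈ ls → 2 ≤ cnt v (args l) → 4 ≤ occ v G → Goal C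
  loop-goal {v} {e} e∈ 2≤e 4≤ with extract e∈
  ... | R₁ , p with pick R₁ (deg⇒∈ {v} (edges R₁) (deg-tail (args e) (edges R₁)
                      (≤-trans (two good (∈-literal⇒∈ᵥ e∈ (cnt⇒∈ (≤-trans (s≤s z≤n) 2≤e))))
                        (≤-reflexive (weight-↭ (ind v) (edges-↭ p))))))
  ...   | f , R , q , v∈f = cut-goal (↭-trans p (prep e q)) (cnt⇒∈ (≤-trans (s≤s z≤n) 2≤e)) v∈f (inj₂ (2≤e , rest))
    where
    -- The arity bound lets the loop use up at most two of the four positions.
    2≤rest : 2 ≤ cnt v (args f) + occ v (edges R)
    2≤rest = +-cancelˡ-≤ 2 2 _ (≤-trans 4≤ (≤-trans
      (≤-reflexive (weight-↭ (cnt v) (edges-↭ (↭-trans p (prep e q)))))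
      (+-monoˡ-≤ _ (≤-trans (cnt≤length v (args e)) (All.lookup (arity≤2 good) e∈)))))
    rest : 2 ≤ cnt v (args f) ⊎ v ∈ᵥ edges R
    rest with v ∈ᵥ? edges R
    ... | yes v∈R = inj₂ v∈R
    ... | no v∉R  = inj₁ (≤-trans 2≤rest (≤-reflexive (trans (cong (cnt v (args f) +_) (occ-∉ v∉R)) (+-identityʳ _))))

  heavy-goal : ∀ {v} → 4 ≤ occ v G → Goal C
  heavy-goal {v} 4≤ with loop-or-simple v ls
  ... | inj₁ (l , l∈ , 2≤) = loop-goal l∈ 2≤ 4≤
  ... | inj₂ occ≤deg with pick ls (deg⇒∈ {v} G (≤-trans (s≤s z≤n) (≤-trans 4≤ occ≤deg)))
  ...   | e , R₁ , p , v∈e with deg-tail {n = 3} (args e) (edges R₁)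
                                (≤-trans (≤-trans 4≤ occ≤deg) (≤-reflexive (weight-↭ (ind v) (edges-↭ p))))
  ...     | 3≤R₁ with pick R₁ (deg⇒∈ {v} (edges R₁) (≤-trans (s≤s z≤n) 3≤R₁))
  ...       | f , R , q , v∈f = cut-goal (↭-trans p (prep e q)) v∈e v∈f
                (inj₁ (deg-tail (args f) (edges R) (≤-trans 3≤R₁ (≤-reflexive (weight-↭ (ind v) (edges-↭ q))))))

-- Variables with at most three positions

module Light (C : Clause) (good : Good (lits C)) (occ≤3 : ∀ x → occ x (edges (lits C)) ≤ 3) where

  open Reduce C good

  deg≤3 : ∀ x → deg x G ≤ 3
  deg≤3 x = ≤-trans (deg≤occ x G) (occ≤3 x)

  ∈-arity≤2 : ∀ {l} → l ∈ ls → arity l ≤ 2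
  ∈-arity≤2 = All.lookup (arity≤2 good)

  small : ∀ {x y} → Small (x ∷ y ∷ []) G
  small = inj₂ (≤-refl , occ≤3)

  deg-resp : ∀ {x n S} → ls ↭ S → n ≤ deg x G → n ≤ deg x (edges S)
  deg-resp {x} p n≤ = ≤-trans n≤ (≤-reflexive (weight-↭ (ind x) (edges-↭ p)))

  in-G : ∀ {x S} → ls ↭ S → x ∈ᵥ edges S → x ∈ᵥ G
  in-G p = Any-resp-↭ (edges-↭ (↭-sym p))

  deg≤3-resp : ∀ {x S} → ls ↭ S → deg x (edges S) ≤ 3
  deg≤3-resp {x} p = ≤-trans (≤-reflexive (sym (weight-↭ (ind x) (edges-↭ p)))) (deg≤3 x)

  module _ (4≤ls : 4 ≤ length ls) where

    pair-goal : ∀ {k l R} c d → ls ↭ k ∷ l ∷ R → (∀ {z} → z ∈ args k ⊎ z ∈ args l → z ∈ᵥ edges R → z ≡ c ⊎ z ≡ d) → Goal C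
    pair-goal {k} {l} {R} c d p sep = partition-goal {k ∷ l ∷ []} {R} {c ∷ d ∷ []} p sep′ (small {c} {d}) (s≤s (s≤s z≤n))
      (s≤s⁻¹ (s≤s⁻¹ (≤-trans 4≤ls (≤-reflexive (↭-length p)))))
      where
      to-∈ : ∀ {z} → z ≡ c ⊎ z ≡ d → z ∈ c ∷ d ∷ []
      to-∈ (inj₁ eq) = here eq
      to-∈ (inj₂ eq) = there (here eq)
      sep′ : Separates (c ∷ d ∷ []) (k ∷ l ∷ []) R
      sep′ (here z∈)         z∈R = to-∈ (sep (inj₁ z∈) z∈R)
      sep′ (there (here z∈)) z∈R = to-∈ (sep (inj₂ z∈) z∈R)

    -- This disposes of parallel literals, and of a loop or unary literal next to another literal.
    cover-goal : ∀ {k l R} c d → ls ↭ k ∷ l ∷ R →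
      (∀ {z} → z ∈ args k → z ≡ c ⊎ z ≡ d) → (∀ {z} → z ∈ args l → z ≡ c ⊎ z ≡ d) → Goal C
    cover-goal c d p onk onl = pair-goal c d p λ { (inj₁ z∈) _ → onk z∈ ; (inj₂ z∈) _ → onl z∈ }

    -- If only `k` and `l` contain `x`, this pair meets the rest at most in the other ends of `k`
    -- and `l`.
    deg≥3-or : ∀ {x} → x ∈ᵥ G → Goal C ⊎ 3 ≤ deg x G
    deg≥3-or {x} x∈ with pick ls x∈
    ... | k , R₁ , p , x∈k with pick R₁ (deg⇒∈ {x} (edges R₁) (deg-tail (args k) (edges R₁) (deg-resp p (two good x∈))))
    ...   | l , R , q , x∈l = by-rest (x ∈ᵥ? edges R)
      where
      pq = ↭-trans p (prep k q)
      kl-ends = other-end x∈k (∈-arity≤2 (∈-resp-↭ (↭-sym pq) (here refl)))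
              , other-end x∈l (∈-arity≤2 (∈-resp-↭ (↭-sym pq) (there (here refl))))
      by-rest : Dec (x ∈ᵥ edges R) → Goal C ⊎ 3 ≤ deg x G
      by-rest (yes x∈R) = inj₂ (≤-trans (s≤s (s≤s (deg-∈ x∈R))) (≤-reflexive (sym (trans (weight-↭ (ind x) (edges-↭ pq))
        (trans (deg-hit (edges (l ∷ R)) x∈k) (cong suc (deg-hit (edges R) x∈l)))))))
      by-rest (no x∉R) with kl-ends
      ... | (c , _ , onk) , (d , _ , onl) = inj₁ (pair-goal c d pq λ
        { (inj₁ z∈) z∈R → case onk z∈ of λ { (inj₁ refl) → contradiction z∈R x∉R ; (inj₂ eq) → inj₁ eq }
        ; (inj₂ z∈) z∈R → case onl z∈ of λ { (inj₁ refl) → contradiction z∈R x∉R ; (inj₂ eq) → inj₂ eq } })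

    -- A colouring that disconnects the premise separates S from the rest along c and d.
    connected-or : ∀ {a E S} c d → ls ↭ E ++ S → 2 ≤ length E → Two ((a ∷ []) ∷ edges S) → a ∈ᵥ edges S →
      (∀ {z} → z ∈ᵥ edges E → z ∈ᵥ edges S → z ≢ a → z ≡ c ⊎ z ≡ d) → Conn ((a ∷ []) ∷ edges S) ⊎ Goal C
    connected-or {a} {E} {S} c d p 2≤E twoS a∈S sep = by-conn (conn? ((a ∷ []) ∷ edges S))
      where
      module _ (χ : ℕ → Bool) (mono : Mono χ (edges S)) {z} (z∈S : z ∈ᵥ edges S) (z≠ : χ z ≢ χ a) where
        by-colour : Goal C
        by-colour with split-colour χ (χ a) S mono
        ... | X , Y , q , onX , onY = partition-goal {E ++ X} {Y} {c ∷ d ∷ []}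
              (↭-trans p (↭-trans (++⁺ˡ E q) (↭-reflexive (sym (++-assoc E X Y))))) sep′ (small {c} {d})
              (≤-trans 2≤E (≤-trans (m≤m+n _ _) (≤-reflexive (sym (length-++ E))))) 2≤Y
          where
          sep′ : Separates (c ∷ d ∷ []) (E ++ X) Y
          sep′ {u} u∈ u∈Y with edges-++-∈ E u∈
          ... | inj₂ u∈X = contradiction (onX u∈X) (onY u∈Y)
          ... | inj₁ u∈E with sep u∈E (Any-resp-↭ (edges-↭ (↭-sym q)) (∈ᵥ-edgesʳ X u∈Y)) (λ { refl → onY u∈Y refl })
          ...   | inj₁ eq = here eq
          ...   | inj₂ eq = there (here eq)
          z∉X : z ∉ᵥ edges X
          z∉X z∈X = z≠ (onX z∈X)
          2≤Y : 2 ≤ length Y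
          2≤Y = begin
            2                                 ≤⟨ twoS (there z∈S) ⟩
            deg z ((a ∷ []) ∷ edges S)        ≡⟨ deg-skip (edges S) (λ { (here refl) → z≠ refl }) ⟩
            deg z (edges S)                   ≡⟨ weight-↭ (ind z) (edges-↭ q) ⟩
            deg z (edges (X ++ Y))            ≡⟨ deg-edges-++ z X ⟩
            deg z (edges X) + deg z (edges Y) ≡⟨ cong (_+ deg z (edges Y)) (deg-∉ z∉X) ⟩
            deg z (edges Y)                   ≤⟨ deg≤length z (edges Y) ⟩
            length (edges Y)                  ≡⟨ length-map args Y ⟩
            length Y                          ∎ where open ≤-Reasoning
      into-S : ∀ {x} → x ∈ᵥ (a ∷ []) ∷ edges S → x ∈ᵥ edges S
      into-S (here (here refl)) = a∈S
      into-S (there x∈)         = x∈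
      by-conn : Conn ((a ∷ []) ∷ edges S) ⊎ (∃[ χ ] Broken χ ((a ∷ []) ∷ edges S)) → Conn ((a ∷ []) ∷ edges S) ⊎ Goal C
      by-conn (inj₁ conn) = inj₁ conn
      by-conn (inj₂ (χ , (_ ∷ mono) , x , y , x∈ , y∈ , x≠y)) with χ x Bool.≟ χ a
      -- As `x` and `y` differ in colour, at least one of them differs from `a`.
      ... | no x≠a  = inj₂ (by-colour χ mono (into-S x∈) x≠a)
      ... | yes x=a = inj₂ (by-colour χ mono (into-S y∈) λ y=a → x≠y (trans x=a (sym y=a)))

    -- The cubic case

    module Cubic (deg≥3 : ∀ {x} → x ∈ᵥ G → 3 ≤ deg x G) where

      -- The far ends of `e`, `f`, `p`, `q` are `u`, `w`, `r`, `s`. The premises consist of the new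
      -- literal at `a` with `S₁` and with `S₂` respectively, and `R` is common to both.
      module Neighbourhoods {g R₀ e f p q R a b u w r s}
        (ls≡ : ls ≡ g ∷ R₀) (R₀↭ : R₀ ↭ e ∷ f ∷ p ∷ q ∷ R)
        (a≢b : a ≢ b) (u≢w : u ≢ w) (r≢s : r ≢ s)
        (a∈g : a ∈ args g) (a∈e : a ∈ args e) (a∈f : a ∈ args f)
        (ong : ∀ {z} → z ∈ args g → z ≡ a ⊎ z ≡ b)
        (one : ∀ {z} → z ∈ args e → z ≡ a ⊎ z ≡ u)
        (onf : ∀ {z} → z ∈ args f → z ≡ a ⊎ z ≡ w)
        (onp : ∀ {z} → z ∈ args p → z ≡ b ⊎ z ≡ r)
        (onq : ∀ {z} → z ∈ args q → z ≡ b ⊎ z ≡ s)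
        (b∉ : b ∉ᵥ edges (e ∷ f ∷ R))
        where

        S₁ S₂ : List Literal
        S₁ = g ∷ p ∷ q ∷ R
        S₂ = e ∷ f ∷ R

        ls↭ : ls ↭ g ∷ e ∷ f ∷ p ∷ q ∷ R
        ls↭ = ↭-trans (↭-reflexive ls≡) (prep g R₀↭)

        ls↭₁ : ls ↭ (e ∷ f ∷ []) ++ S₁
        ls↭₁ = ↭-trans ls↭ (shifts (g ∷ []) (e ∷ f ∷ []))

        ls↭₂ : ls ↭ (p ∷ q ∷ g ∷ []) ++ S₂
        ls↭₂ = ↭-trans ls↭ (↭-trans (prep g (shifts (e ∷ f ∷ []) (p ∷ q ∷ []))) (shifts (g ∷ []) (p ∷ q ∷ [])))

        not-both-ef : ∀ {x} → x ≢ a → ¬ (x ∈ args e × x ∈ args f)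
        not-both-ef x≢a (x∈e , x∈f) with one x∈e | onf x∈f
        ... | inj₁ x≡a  | _         = x≢a x≡a
        ... | inj₂ _    | inj₁ x≡a  = x≢a x≡a
        ... | inj₂ refl | inj₂ refl = u≢w refl

        not-both-pq : ∀ {x} → x ≢ b → ¬ (x ∈ args p × x ∈ args q)
        not-both-pq x≢b (x∈p , x∈q) with onp x∈p | onq x∈q
        ... | inj₁ x≡b  | _         = x≢b x≡b
        ... | inj₂ _    | inj₁ x≡b  = x≢b x≡b
        ... | inj₂ refl | inj₂ refl = r≢s refl

        tail : ∀ {x a S} → x ≢ a → x ∈ᵥ (a ∷ []) ∷ edges S → x ∈ᵥ edges S
        tail x≢a (here (here x≡a)) = contradiction x≡a x≢a
        tail x≢a (there x∈)        = x∈

        two-a : ∀ {l} S → a ∈ args l → 2 ≤ deg a ((a ∷ []) ∷ edges (l ∷ S))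
        two-a {l} S a∈l = ≤-trans (s≤s (deg-∈ {a} {G = edges (l ∷ S)} (here a∈l)))
          (≤-reflexive (sym (deg-hit {a} {a ∷ []} (edges (l ∷ S)) (here refl))))

        Two-at : ∀ {S} → 2 ≤ deg a ((a ∷ []) ∷ edges S) →
          (∀ {x} → x ≢ a → x ∈ᵥ edges S → 2 ≤ deg x (edges S)) → Two ((a ∷ []) ∷ edges S)
        Two-at {S} at-a off-a {x} x∈ = by-dec (x ≟ a)
          where
          by-dec : Dec (x ≡ a) → 2 ≤ deg x ((a ∷ []) ∷ edges S)
          by-dec (yes x≡a) = transport (λ x → 2 ≤ deg x ((a ∷ []) ∷ edges S)) (sym x≡a) at-a
          by-dec (no x≢a)  = ≤-trans (off-a x≢a (tail x≢a x∈)) (m≤n+m (deg x (edges S)) (ind x (a ∷ [])))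

        -- Away from `a` at most one of three literals is lost, as `e` and `f` have different far
        -- ends; at `a` the new literal joins `g`.
        two₁ : Two ((a ∷ []) ∷ edges S₁)
        two₁ = Two-at {S₁} (two-a {g} (p ∷ q ∷ R) a∈g) λ {x} x≢a x∈ →
          deg-drop {x} {args e} {args f} (edges S₁) (not-both-ef x≢a)
            (deg-resp {x} ls↭₁ (deg≥3 (in-G ls↭₁ (∈ᵥ-edgesʳ (e ∷ f ∷ []) {S₁} x∈))))

        -- `b` no longer occurs and `g` has no ends besides `a` and `b`, so away from `a` at most
        -- one of `p` and `q` is lost; at `a` the new literal joins `e`.
        two₂ : Two ((a ∷ []) ∷ edges S₂)
        two₂ = Two-at {S₂} (two-a {e} (f ∷ R) a∈e) off-a
          where
          off-a : ∀ {x} → x ≢ a → x ∈ᵥ edges S₂ → 2 ≤ deg x (edges S₂)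
          off-a {x} x≢a x∈ = ≤-trans (deg-drop {x} {args p} {args q} (edges (g ∷ S₂)) (not-both-pq x≢b)
              (deg-resp {x} ls↭₂ (deg≥3 (in-G ls↭₂ (∈ᵥ-edgesʳ (p ∷ q ∷ g ∷ []) {S₂} x∈)))))
              (≤-reflexive (deg-skip (edges S₂) x∉g))
            where
            x≢b : x ≢ b
            x≢b refl = b∉ x∈
            x∉g : x ∉ args g
            x∉g x∈g with ong x∈g
            ... | inj₁ x≡a = x≢a x≡a
            ... | inj₂ x≡b = x≢b x≡b

        occ-resp : ∀ {S} x → ls ↭ S → occ x (edges S) ≤ 3
        occ-resp x π = ≤-trans (≤-reflexive (sym (weight-↭ (cnt x) (edges-↭ π)))) (occ≤3 x)

        rigid₁ : Rigid ((a ∷ []) ∷ edges S₁)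
        rigid₁ = occ≤3⇒Rigid λ x → occ-replace x (edges S₁) a∈f
          (occ-tail x (args e) (edges (f ∷ S₁)) (occ-resp x ls↭₁))

        rigid₂ : Rigid ((a ∷ []) ∷ edges S₂)
        rigid₂ = occ≤3⇒Rigid λ x → occ-replace x (edges S₂) a∈g
          (occ-tail x (args q) (edges (g ∷ S₂)) (occ-tail x (args p) (edges (q ∷ g ∷ S₂)) (occ-resp x ls↭₂)))

        conn₁ : Conn ((a ∷ []) ∷ edges S₁) ⊎ Goal C
        conn₁ = connected-or {E = e ∷ f ∷ []} {S₁} u w ls↭₁ (s≤s (s≤s z≤n)) two₁ (here a∈g) λ
          { (here z∈)         _ z≢a → case one z∈ of λ { (inj₁ z≡a) → contradiction z≡a z≢a ; (inj₂ eq) → inj₁ eq }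
          ; (there (here z∈)) _ z≢a → case onf z∈ of λ { (inj₁ z≡a) → contradiction z≡a z≢a ; (inj₂ eq) → inj₂ eq } }

        conn₂ : Conn ((a ∷ []) ∷ edges S₂) ⊎ Goal C
        conn₂ = connected-or {E = p ∷ q ∷ g ∷ []} {S₂} r s ls↭₂ (s≤s (s≤s z≤n)) two₂ (here a∈e) λ
          { (here z∈)         z∈S _ → case onp z∈ of λ { (inj₁ refl) → contradiction z∈S b∉ ; (inj₂ eq) → inj₁ eq }
          ; (there (here z∈)) z∈S _ → case onq z∈ of λ { (inj₁ refl) → contradiction z∈S b∉ ; (inj₂ eq) → inj₂ eq }
          ; (there (there (here z∈))) z∈S z≢a → case ong z∈ of λ
              { (inj₁ z≡a) → contradiction z≡a z≢a ; (inj₂ refl) → contradiction z∈S b∉ } }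

        -- The literal `g` is the head if there is one; otherwise it stays in the body of the first
        -- premise.
        body-without : ∀ {P B₀} → R₀ ↭ P ++ B₀ →
          ∃[ B ] (headList h ++ B ≡ g ∷ B₀ × body C ↭ P ++ B × (∀ {M} → M ∈ B₀ → M ∈ B))
        body-without {P} {B₀} π = by-head h ls≡
          where
          by-head : ∀ h → headList h ++ body C ≡ g ∷ R₀ →
            ∃[ B ] (headList h ++ B ≡ g ∷ B₀ × body C ↭ P ++ B × (∀ {M} → M ∈ B₀ → M ∈ B))
          by-head (just l) eq = B₀ , cong (_∷ B₀) (proj₁ (∷-injective eq)) ,
            ↭-trans (↭-reflexive (proj₂ (∷-injective eq))) π , id
          by-head nothing  eq = g ∷ B₀ , refl ,
            ↭-trans (↭-reflexive eq) (↭-trans (prep g π) (↭-sym (shift g P B₀))) , there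

        -- Away from `a`, a variable of `e` or `f` lies in two literals of `S₂`, at most one of
        -- which is `e` or `f`. So some common literal contains it, and factoring that literal
        -- identifies the two copies of the variable.
        linked : ∀ {x} → x ∈ᵥ edges (e ∷ f ∷ []) → x ∈ᵥ edges (new (a ∷ []) ∷ R)
        linked {x} x∈ with x ≟ a
        ... | yes refl = here (here refl)
        ... | no x≢a   = there (deg⇒∈ (edges R) (deg-drop (edges R) (not-both-ef x≢a)
                (≤-trans (two₂ {x} (there (∈ᵥ-edgesˡ (e ∷ f ∷ []) x∈)))
                  (≤-reflexive (deg-skip {x} {a ∷ []} (edges S₂) λ { (here x≡a) → x≢a x≡a })))))

        finish : Conn ((a ∷ []) ∷ edges S₁) → Conn ((a ∷ []) ∷ edges S₂) →
          ∃[ B ] (headList h ++ B ≡ S₁ × body C ↭ (e ∷ f ∷ []) ++ B × (∀ {M} → M ∈ p ∷ q ∷ R → M ∈ B)) → Goal C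
        finish c₁ c₂ (B , h++B , body↭ , B₀⊆B) = combine body↭ (λ M∈ → B₀⊆B (there (there M∈))) (λ x∈ _ → linked x∈)
          (transport (λ X → Good (new (a ∷ []) ∷ X)) (sym h++B)
            (good-part (↭-trans ls↭₁ (++-comm (e ∷ f ∷ []) S₁)) ≤-refl (s≤s z≤n) c₁ two₁ rigid₁))
          (Good-↭ (prep _ (++-comm (e ∷ f ∷ []) R))
            (good-part (↭-trans ls↭₂ (++-comm (p ∷ q ∷ g ∷ []) S₂)) ≤-refl (s≤s z≤n) c₂ two₂ rigid₂))
          ≤-refl size<
          where
          R+2≤B : ∀ h → headList h ++ B ≡ S₁ → suc (suc (length R)) ≤ length B
          R+2≤B (just l) eq = ≤-reflexive (cong length (sym (proj₂ (∷-injective eq))))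
          R+2≤B nothing  eq = ≤-trans (n≤1+n _) (≤-reflexive (cong length (sym eq)))
          size< : length (R ++ e ∷ f ∷ []) < size C
          size< = begin
            suc (length (R ++ e ∷ f ∷ [])) ≡⟨ cong suc (↭-length (++-comm R (e ∷ f ∷ []))) ⟩
            3 + length R                   ≤⟨ n≤1+n _ ⟩
            4 + length R                   ≤⟨ +-monoʳ-≤ 2 (R+2≤B h h++B) ⟩
            2 + length B                   ≡⟨ ↭-length body↭ ⟨
            size C                         ∎ where open ≤-Reasoning

        goal : Goal C
        goal = [ (λ c₁ → [ (λ c₂ → finish c₁ c₂ (body-without R₀↭)) , id ]′ conn₂) , id ]′ conn₁

      record Ends (x : ℕ) (l : Literal) : Set where
        field
          {end} : ℕ
          x∈l   : x ∈ args l
          on    : ∀ {z} → z ∈ args l → z ≡ x ⊎ z ≡ end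
      open Ends

      ends : ∀ {x l} → l ∈ ls → x ∈ args l → Ends x l
      ends l∈ x∈l with other-end x∈l (∈-arity≤2 l∈)
      ... | y , _ , on = record { end = y ; x∈l = x∈l ; on = on }

      pick₂ : ∀ {x} S → (∀ {l} → l ∈ S → l ∈ ls) → 2 ≤ deg x (edges S) →
        ∃[ k ] ∃[ l ] ∃[ R ] (S ↭ k ∷ l ∷ R × Ends x k × Ends x l)
      pick₂ {x} S S⊆ls 2≤ with pick S (deg⇒∈ {x} (edges S) (≤-trans (s≤s z≤n) 2≤))
      ... | k , R₁ , p , x∈k with pick R₁ (deg⇒∈ {x} (edges R₁) (deg-tail (args k) (edges R₁)
                                   (≤-trans 2≤ (≤-reflexive (weight-↭ (ind x) (edges-↭ p))))))
      ...   | l , R , q , x∈l = k , l , R , π , ends (back (here refl)) x∈k , ends (back (there (here refl))) x∈l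
        where
        π : S ↭ k ∷ l ∷ R
        π = ↭-trans p (prep k q)
        back : ∀ {m} → m ∈ k ∷ l ∷ R → m ∈ ls
        back m∈ = S⊆ls (∈-resp-↭ (↭-sym π) m∈)

      module _ {g R₀} (ls≡ : ls ≡ g ∷ R₀) where

        cubic-goal : Goal C
        cubic-goal = from-a (nonempty (All.lookup (arity≥1 good) g∈ls))
          where
          g∈ls : g ∈ ls
          g∈ls = transport (g ∈_) (sym ls≡) (here refl)

          R₀⊆ls : ∀ {l} → l ∈ R₀ → l ∈ ls
          R₀⊆ls l∈ = transport (_ ∈_) (sym ls≡) (there l∈)

          module _ {a b e f R₂} (a∈g : a ∈ args g) (b∈g : b ∈ args g) (ong : ∀ {z} → z ∈ args g → z ≡ a ⊎ z ≡ b)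
            (π : R₀ ↭ e ∷ f ∷ R₂) (E : Ends a e) (F : Ends a f) where

            ls↭ : ls ↭ g ∷ e ∷ f ∷ R₂
            ls↭ = ↭-trans (↭-reflexive ls≡) (prep g π)

            ls↭gf : ls ↭ g ∷ f ∷ e ∷ R₂
            ls↭gf = ↭-trans ls↭ (prep g (swap e f refl))

            ls↭ef : ls ↭ e ∷ f ∷ g ∷ R₂
            ls↭ef = ↭-trans ls↭ (shifts (g ∷ []) (e ∷ f ∷ []))

            module _ (a≢b : a ≢ b) (u≢b : end E ≢ b) (w≢b : end F ≢ b) (u≢w : end E ≢ end F) where

              b∉end : ∀ {l} (L : Ends a l) → end L ≢ b → b ∉ args l
              b∉end L end≢b b∈ with on L b∈
              ... | inj₁ b≡a = a≢b (sym b≡a)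
              ... | inj₂ b≡u = end≢b (sym b≡u)

              2≤R₂ : 2 ≤ deg b (edges R₂)
              2≤R₂ = ≤-trans (deg-tail {b} (args g) (edges (e ∷ f ∷ R₂)) (deg-resp {b} ls↭ (deg≥3 (∈-literal⇒∈ᵥ g∈ls b∈g))))
                (≤-reflexive (trans (deg-skip (edges (f ∷ R₂)) (b∉end E u≢b)) (deg-skip (edges R₂) (b∉end F w≢b))))

              R₂⊆ls : ∀ {l} → l ∈ R₂ → l ∈ ls
              R₂⊆ls l∈ = ∈-resp-↭ (↭-sym ls↭) (there (there (there l∈)))

              from-pq : ∃[ p ] ∃[ q ] ∃[ R ] (R₂ ↭ p ∷ q ∷ R × Ends b p × Ends b q) → Goal C
              from-pq (p , q , R , ρ , P , Q) = by-dec (end P ≟ end Q)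
                where
                ls↭pq : ls ↭ p ∷ q ∷ g ∷ e ∷ f ∷ R
                ls↭pq = ↭-trans ls↭ (↭-trans (++⁺ˡ (g ∷ e ∷ f ∷ []) ρ) (shifts (g ∷ e ∷ f ∷ []) (p ∷ q ∷ [])))
                -- `p`, `q` and `g` already account for the three literals that may contain `b`.
                b∉ : b ∉ᵥ edges (e ∷ f ∷ R)
                b∉ b∈ = contradiction
                  (≤-trans (≤-trans (s≤s (s≤s (s≤s (deg-∈ b∈)))) (≤-reflexive (sym
                    (trans (deg-hit {b} (edges (q ∷ g ∷ e ∷ f ∷ R)) (x∈l P)) (cong suc
                    (trans (deg-hit {b} (edges (g ∷ e ∷ f ∷ R)) (x∈l Q)) (cong suc
                    (deg-hit {b} (edges (e ∷ f ∷ R)) b∈g)))))))) (deg≤3-resp {b} ls↭pq))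
                  (n≮n 3)
                by-dec : Dec (end P ≡ end Q) → Goal C
                by-dec (yes eq) = cover-goal b (end P) ls↭pq (on P)
                  (λ z∈ → [ inj₁ , (λ z≡ → inj₂ (trans z≡ (sym eq))) ]′ (on Q z∈))
                by-dec (no r≢s) = Neighbourhoods.goal ls≡ (↭-trans π (++⁺ˡ (e ∷ f ∷ []) ρ)) a≢b u≢w r≢s
                  a∈g (x∈l E) (x∈l F) ong (on E) (on F) (on P) (on Q) b∉

              distinct-goal : Goal C
              distinct-goal = from-pq (pick₂ R₂ R₂⊆ls 2≤R₂)

            along : ∀ {l c} (L : Ends a l) → end L ≡ c → ∀ {z} → z ∈ args l → z ≡ a ⊎ z ≡ c
            along L refl z∈ = on L z∈

            -- Each coincidence of ends confines two of the literals `g`, `e`, `f` to two variables.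
            from-ef : Dec (a ≡ b) → Dec (end E ≡ b) → Dec (end F ≡ b) → Dec (end E ≡ end F) → Goal C
            from-ef (yes a≡b) _ _ _ = cover-goal a (end E) ls↭
              (λ z∈ → inj₁ ([ id , (λ z≡b → trans z≡b (sym a≡b)) ]′ (ong z∈))) (on E)
            from-ef (no _) (yes u≡b) _ _ = cover-goal a b ls↭ ong (along E u≡b)
            from-ef (no _) (no _) (yes w≡b) _ = cover-goal a b ls↭gf ong (along F w≡b)
            from-ef (no _) (no _) (no _) (yes u≡w) = cover-goal a (end E) ls↭ef (on E) (along F (sym u≡w))
            from-ef (no a≢b) (no u≢b) (no w≢b) (no u≢w) = distinct-goal a≢b u≢b w≢b u≢w

          from-a : ∃[ a ] a ∈ args g → Goal C
          from-a (a , a∈g) = from-b (other-end a∈g (∈-arity≤2 g∈ls)) (pick₂ {a} R₀ R₀⊆ls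
              (deg-tail {a} (args g) (edges R₀) (deg-resp {a} (↭-reflexive ls≡) (deg≥3 (∈-literal⇒∈ᵥ g∈ls a∈g)))))
            where
            from-b : ∃[ b ] (b ∈ args g × (∀ {z} → z ∈ args g → z ≡ a ⊎ z ≡ b)) →
              ∃[ e ] ∃[ f ] ∃[ R ] (R₀ ↭ e ∷ f ∷ R × Ends a e × Ends a f) → Goal C
            from-b (b , b∈g , ong) (e , f , R₂ , π , E , F) =
              from-ef a∈g b∈g ong π E F (a ≟ b) (end E ≟ b) (end F ≟ b) (end E ≟ end F)

-- Assembling the cases

few-goal : ∀ C (good : Good (lits C)) → (∀ x → occ x (edges (lits C)) ≤ 3) → ¬ (4 ≤ length (lits C)) → 2 < size C → Goal C
-- With more than two body literals but fewer than four literals in all, the clause has no head and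
-- three body literals. One of them is split off, and its own arguments are the variables to carry.
few-goal C@(clause nothing (k ∷ l ∷ m ∷ [])) good occ≤3 _ _ = separate {k ∷ l ∷ []} {m ∷ []} {args m} ↭-refl
  (λ { (here z∈) _ → z∈ }) (inj₂ (∈-arity≤2 (there (there (here refl))) , occ≤3)) ≤-refl ≤-refl
  where
  open Reduce C good
  open Light C good occ≤3
few-goal (clause (just _) (_ ∷ _ ∷ _ ∷ _))    _ _ ≱4 _ = contradiction (s≤s (s≤s (s≤s (s≤s z≤n)))) ≱4
few-goal (clause nothing (_ ∷ _ ∷ _ ∷ _ ∷ _)) _ _ ≱4 _ = contradiction (s≤s (s≤s (s≤s (s≤s z≤n)))) ≱4
few-goal (clause _ (_ ∷ []))     _ _ _ (s≤s ())
few-goal (clause _ (_ ∷ _ ∷ [])) _ _ _ (s≤s (s≤s ()))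

many-goal : ∀ C (good : Good (lits C)) → (∀ x → occ x (edges (lits C)) ≤ 3) → 4 ≤ length (lits C) → Goal C
many-goal C good occ≤3 4≤ = by-deg (all-or (concat G) λ x∈ → deg≥3-or 4≤ (∈-concat⁻ G x∈))
  where
  open Reduce C good
  open Light C good occ≤3
  by-deg : Goal C ⊎ (∀ {x} → x ∈ concat G → 3 ≤ deg x G) → Goal C
  by-deg (inj₁ goal)  = goal
  by-deg (inj₂ deg≥3) = first ls refl
    where
    first : ∀ ls′ → ls ≡ ls′ → Goal C
    -- Taking the first literal for `g` makes it the head whenever there is one.
    first (g ∷ R₀) eq = Cubic.cubic-goal 4≤ (λ x∈ → deg≥3 (∈-concat⁺ x∈)) eq
    first []       eq = contradiction (≤-trans 4≤ (≤-reflexive (cong length eq))) λ ()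

reduce : ∀ C → Good (lits C) → 2 < size C → Goal C
reduce C good 2<size = by-occ (any? (λ x → 4 ≤? occ x G) (concat G))
  where
  G = edges (lits C)
  by-occ : Dec (Any (λ x → 4 ≤ occ x G) (concat G)) → Goal C
  by-occ (yes heavy) = Heavy-variable.heavy-goal C good (proj₂ (proj₂ (find heavy)))
  by-occ (no ¬heavy) = by-size (4 ≤? length (lits C))
    where
    occ≤3 : ∀ x → occ x G ≤ 3
    occ≤3 x with x ∈ᵥ? G
    ... | yes x∈ = s≤s⁻¹ (≰⇒> λ 4≤ → ¬heavy (lose (∈-concat⁺ x∈) 4≤))
    ... | no x∉  = ≤-trans (≤-reflexive (occ-∉ x∉)) z≤n
    by-size : Dec (4 ≤ length (lits C)) → Goal C
    by-size (yes 4≤) = many-goal C good occ≤3 4≤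
    by-size (no ≱4)  = few-goal C good occ≤3 ≱4 2<size

mainTheorem10 : ∀ (C : Clause) → H2c∞ 2 C → 2 < size C →
    ∃[ b′ ] (b′ < size C × ∃[ C₁ ] ∃[ C₂ ]
    (H2c 2 b′ C₁ × H2c 2 b′ C₂ × ConclusionOf C₁ C₂ C))
mainTheorem10 C h2c = reduce C (H2c∞⇒Good C h2c)
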